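{- Let $r\ge1$, $s\ge2$, and let $P_1(\underline{x}),\ldots,P_s(\underline{x})\in\mathbb{Z}[\underline{x}]$ be nonzero polynomials in $r$ variables $\underline{x}=(x_1,\ldots,x_r)$. Let $\ell=\max(\deg P_1,\ldots,\deg P_s)$, let $S$ be a nonempty finite subset of $\mathbb{Z}$, and let $k>0$ be a real number. For $\underline{n}\in\mathbb{Z}^r$ put $d_{\underline{n}}=\gcd(P_1(\underline{n}),\ldots,P_s(\underline{n}))$. If $$\frac{\#\{\underline{n}\in S^r\mid d_{\underline{n}}\le k\}}{\#S^r}>\frac{(2k+1)\,\ell}{\#S},$$ then $P_1(\underline{x}),\ldots,P_s(\underline{x})$ are coprime polynomials.
   Context: Polynomials $P_1,\ldots,P_s\in\mathbb{Z}[\underline{x}]$ are called coprime if no polynomial $D\in\mathbb{Q}[\underline{x}]$ with $\deg D>0$ divides all of them in $\mathbb{Q}[\underline{x}]$. Degrees are total degrees. The gcd of integers is the nonnegative one, with $\gcd(0,\ldots,0)=0$. -}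

module Defs where

open import Algebra.Bundles using (CommutativeRing)
open import Algebra.Bundles.Raw using (RawMagma)
import Algebra.Definitions.RawMagma
import Algebra.Properties.Semiring.Exp
open import Data.Fin.Base using (Fin)
open import Data.Integer.Base as ℤ using (ℤ; +_; 0ℤ)
import Data.Integer.GCD as ℤ
import Data.Integer.Properties as ℤ
open import Data.List.Base as List using (List; []; _∷_; length; cartesianProductWith)
open import Data.List.Extrema.Nat using (max)
open import Data.List.Membership.Propositional using (_∈_)
import Data.List.Properties as List
open import Data.List.Relation.Unary.Unique.Propositional using (Unique)
open import Data.Nat.Base as ℕ using (ℕ; zero; suc)
import Data.Nat.Properties as ℕ
open import Data.Product.Base using (Σ-syntax; ∃-syntax; _×_; _,_; proj₁; proj₂; map₁)
open import Data.Rational.Base as ℚ using (ℚ; 0ℚ; 1ℚ; ½)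
import Data.Rational.Properties as ℚ
open import Data.Rational.Solver using (module +-*-Solver)
open import Data.Vec.Base as Vec using (Vec; []; _∷_)
import Data.Vec.Functional as Vector
import Data.Vec.Properties as Vec
open import Function.Bundles using (_⇔_)
open import Level using (Level; _⊔_)
open import Relation.Binary.Definitions using (Decidable)
open import Relation.Binary.PropositionalEquality
open import Relation.Nullary.Decidable using (¬?)
open import Relation.Nullary.Negation.Core using (¬_)

------------------------------------------------------------------------
-- Polynomials in r variables over a commutative ring

module Polynomial {c ℓ : Level} (R : CommutativeRing c ℓ)
                  (_≟_ : Decidable (CommutativeRing._≈_ R)) where

  open CommutativeRing R
  open Algebra.Properties.Semiring.Exp semiring using (_^_)

  -- A formal sum of terms a·x^e, listed as pairs (a , e) with e the vector
  -- of exponents.  Exponents may repeat and coefficients may vanish, so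
  -- equality of polynomials is _≈ₚ_, not _≡_.

  Poly : ℕ → Set c
  Poly r = List (Carrier × Vec ℕ r)

  coeff : ∀ {r} → Poly r → Vec ℕ r → Carrier
  coeff p e = List.foldr _+_ 0#
    (List.map proj₁ (List.filter (λ t → Vec.≡-dec ℕ._≟_ (proj₂ t) e) p))

  infix 4 _≈ₚ_

  _≈ₚ_ : ∀ {r} → Poly r → Poly r → Set ℓ
  p ≈ₚ q = ∀ e → coeff p e ≈ coeff q e

  0ₚ : ∀ {r} → Poly r
  0ₚ = []

  infixl 7 _*ₚ_

  _*ₚ_ : ∀ {r} → Poly r → Poly r → Poly r
  _*ₚ_ = cartesianProductWith
    (λ (a , d) (b , e) → a * b , Vec.zipWith ℕ._+_ d e)

  *ₚ-rawMagma : ℕ → RawMagma c ℓ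
  *ₚ-rawMagma r = record { Carrier = Poly r ; _≈_ = _≈ₚ_ ; _∙_ = _*ₚ_ }

  module _ {r : ℕ} where
    open Algebra.Definitions.RawMagma (*ₚ-rawMagma r) public using (_∣_)

  -- Total degree; the zero polynomial gets degree 0.

  deg : ∀ {r} → Poly r → ℕ
  deg p = max 0 (List.map Vec.sum
    (List.filter (λ e → ¬? (coeff p e ≟ 0#)) (List.map proj₂ p)))

  eval : ∀ {r} → Poly r → Vec Carrier r → Carrier
  eval p x = List.foldr _+_ 0#
    (List.map (λ (a , e) → a * Vec.foldr′ _*_ 1# (Vec.zipWith _^_ x e)) p)

module ℤ[X] = Polynomial ℤ.+-*-commutativeRing ℤ._≟_
module ℚ[X] = Polynomial ℚ.+-*-commutativeRing ℚ._≟_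

toℚ[X] : ∀ {r} → ℤ[X].Poly r → ℚ[X].Poly r
toℚ[X] = List.map (map₁ (λ a → a ℚ./ 1))

Coprime : ∀ {r s} → (Fin s → ℤ[X].Poly r) → Set
Coprime {r} P =
  ¬ (Σ[ D ∈ ℚ[X].Poly r ] 0 ℕ.< ℚ[X].deg D × (∀ i → D ℚ[X].∣ toℚ[X] (P i)))

maxDeg : ∀ {r s} → (Fin s → ℤ[X].Poly r) → ℕ
maxDeg P = Vector.foldr ℕ._⊔_ 0 (λ i → ℤ[X].deg (P i))

gcdAt : ∀ {r s} → (Fin s → ℤ[X].Poly r) → Vec ℤ r → ℤ
gcdAt P n = Vector.foldr ℤ.gcd 0ℤ (λ i → ℤ[X].eval (P i) n)

------------------------------------------------------------------------
-- A relation, not a count: membership in {n ∣ d n ≤ k} is undecidable for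
-- real k.

HasCardinality : ∀ {a p} {A : Set a} → (A → Set p) → ℕ → Set (a ⊔ p)
HasCardinality {A = A} Q N =
  Σ[ xs ∈ List A ] Unique xs × (∀ x → x ∈ xs ⇔ Q x) × length xs ≡ N

-- The cartesian power S^r; duplicate-free whenever S is.

power : ∀ {a} {A : Set a} → List A → (r : ℕ) → List (Vec A r)
power S zero    = [] ∷ []
power S (suc r) = cartesianProductWith _∷_ S (power S r)

power-nonZero : ∀ {a} {A : Set a} (S : List A) (r : ℕ) →
                .{{ℕ.NonZero (length S)}} → ℕ.NonZero (length (power S r))
power-nonZero S       zero    = _
power-nonZero (x ∷ S) (suc r) with power (x ∷ S) r | power-nonZero (x ∷ S) r
... | _ ∷ _ | _ = _

------------------------------------------------------------------------
-- Real numbers, as Cauchy sequences of rationals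

IsCauchy : (ℕ → ℚ) → Set
IsCauchy x = ∀ ε → 0ℚ ℚ.< ε → ∃[ N ] ∀ m n → N ℕ.≤ m → N ℕ.≤ n →
             ℚ.∣ x m ℚ.- x n ∣ ℚ.< ε

record ℝ : Set where
  field
    seq    : ℕ → ℚ
    cauchy : IsCauchy seq

open ℝ public

infix 4 _<ℝ_ _≤ℝ_

-- The positive rational gap δ makes these relations respect equality of
-- limits.

_<ℝ_ : ℝ → ℝ → Set
x <ℝ y = Σ[ δ ∈ ℚ ] 0ℚ ℚ.< δ ×
         (∃[ N ] ∀ n → N ℕ.≤ n → seq x n ℚ.+ δ ℚ.≤ seq y n)

_≤ℝ_ : ℝ → ℝ → Set
x ≤ℝ y = ¬ (y <ℝ x)

fromℚ : ℚ → ℝ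
fromℚ q .seq    _ = q
fromℚ q .cauchy ε 0<ε = 0 , λ _ _ _ _ →
  subst (λ d → ℚ.∣ d ∣ ℚ.< ε) (sym (ℚ.+-inverseʳ q)) 0<ε

fromℤ : ℤ → ℝ
fromℤ a = fromℚ (a ℚ./ 1)

private
  +-interchange : ∀ a b c d →
    (a ℚ.+ b) ℚ.- (c ℚ.+ d) ≡ (a ℚ.- c) ℚ.+ (b ℚ.- d)
  +-interchange = solve 4 (λ a b c d →
    (a :+ b) :- (c :+ d) := (a :- c) :+ (b :- d)) refl
    where open +-*-Solver

  *-telescope : ∀ a b c d →
    a ℚ.* b ℚ.- c ℚ.* d ≡ a ℚ.* (b ℚ.- d) ℚ.+ d ℚ.* (a ℚ.- c)
  *-telescope = solve 4 (λ a b c d →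
    a :* b :- c :* d := a :* (b :- d) :+ d :* (a :- c)) refl
    where open +-*-Solver

  sub-add : ∀ a b → a ≡ (a ℚ.- b) ℚ.+ b
  sub-add = solve 2 (λ a b → a := (a :- b) :+ b) refl
    where open +-*-Solver

  half-pos : ∀ ε → 0ℚ ℚ.< ε → 0ℚ ℚ.< ε ℚ.* ½
  half-pos ε 0<ε = subst (ℚ._< ε ℚ.* ½) (ℚ.*-zeroˡ ½) (ℚ.*-monoˡ-<-pos ½ 0<ε)

  half+half : ∀ ε → ε ℚ.* ½ ℚ.+ ε ℚ.* ½ ≡ ε
  half+half ε = trans (sym (ℚ.*-distribˡ-+ ε ½ ½)) (ℚ.*-identityʳ ε)

  ∣+∣-< : ∀ {a b A B} → ℚ.∣ a ∣ ℚ.< A → ℚ.∣ b ∣ ℚ.< B → ℚ.∣ a ℚ.+ b ∣ ℚ.< A ℚ.+ B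
  ∣+∣-< {a} {b} {A} {B} a<A b<B =
    ℚ.≤-<-trans (ℚ.∣p+q∣≤∣p∣+∣q∣ a b)
                (ℚ.+-mono-< {ℚ.∣ a ∣} {A} {ℚ.∣ b ∣} {B} a<A b<B)

  ∣*∣-< : ∀ {a d A δ} → 0ℚ ℚ.< A → ℚ.∣ a ∣ ℚ.≤ A → ℚ.∣ d ∣ ℚ.< δ →
          ℚ.∣ a ℚ.* d ∣ ℚ.< A ℚ.* δ
  ∣*∣-< {a} {d} {A} {δ} 0<A a≤A d<δ =
    subst (ℚ._< A ℚ.* δ) (sym (ℚ.∣p*q∣≡∣p∣*∣q∣ a d))
      (ℚ.≤-<-trans
        (ℚ.*-monoʳ-≤-nonNeg ℚ.∣ d ∣ {{ℚ.nonNegative (ℚ.0≤∣p∣ d)}} {ℚ.∣ a ∣} {A} a≤A)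
        (ℚ.*-monoʳ-<-pos A {{ℚ.positive 0<A}} {ℚ.∣ d ∣} {δ} d<δ))

  split : ∀ A ε → 0ℚ ℚ.< A → 0ℚ ℚ.< ε → Σ[ δ ∈ ℚ ] 0ℚ ℚ.< δ × A ℚ.* δ ≡ ε
  split A ε 0<A 0<ε = δ , 0<δ , A*δ≡ε
    where
    instance
      A-pos : ℚ.Positive A
      A-pos = ℚ.positive 0<A
      A-nonZero : ℚ.NonZero A
      A-nonZero = ℚ.pos⇒nonZero A
    δ = ℚ.1/ A ℚ.* ε
    0<δ = ℚ.positive⁻¹ δ
      {{ℚ.pos*pos⇒pos (ℚ.1/ A) {{ℚ.1/pos⇒pos A}} ε {{ℚ.positive 0<ε}}}}
    A*δ≡ε : A ℚ.* δ ≡ ε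
    A*δ≡ε = trans (sym (ℚ.*-assoc A (ℚ.1/ A) ε))
              (trans (cong (ℚ._* ε) (ℚ.*-inverseʳ A)) (ℚ.*-identityˡ ε))

  +-cauchy : ∀ {x y} → IsCauchy x → IsCauchy y → IsCauchy (λ n → x n ℚ.+ y n)
  +-cauchy {x} {y} cx cy ε 0<ε
    with cx (ε ℚ.* ½) (half-pos ε 0<ε) | cy (ε ℚ.* ½) (half-pos ε 0<ε)
  ... | M , hx | N , hy = M ℕ.⊔ N , λ m n m≥ n≥ →
    subst₂ (λ d e → ℚ.∣ d ∣ ℚ.< e)
      (sym (+-interchange (x m) (y m) (x n) (y n))) (half+half ε)
      (∣+∣-< {x m ℚ.- x n} {y m ℚ.- y n}
        (hx m n (ℕ.m⊔n≤o⇒m≤o M N m≥) (ℕ.m⊔n≤o⇒m≤o M N n≥))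
        (hy m n (ℕ.m⊔n≤o⇒n≤o M N m≥) (ℕ.m⊔n≤o⇒n≤o M N n≥)))

  bounded : ∀ {x} → IsCauchy x →
            Σ[ B ∈ ℚ ] 0ℚ ℚ.< B × (∃[ N ] ∀ n → N ℕ.≤ n → ℚ.∣ x n ∣ ℚ.≤ B)
  bounded {x} cx with cx 1ℚ (ℚ.positive⁻¹ 1ℚ)
  ... | N , h = 1ℚ ℚ.+ ℚ.∣ x N ∣
              , ℚ.+-mono-<-≤ {0ℚ} {1ℚ} {0ℚ} {ℚ.∣ x N ∣}
                  (ℚ.positive⁻¹ 1ℚ) (ℚ.0≤∣p∣ (x N))
              , N , λ n n≥ →
    subst (λ d → ℚ.∣ d ∣ ℚ.≤ 1ℚ ℚ.+ ℚ.∣ x N ∣) (sym (sub-add (x n) (x N)))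
      (ℚ.≤-trans (ℚ.∣p+q∣≤∣p∣+∣q∣ (x n ℚ.- x N) (x N))
        (ℚ.+-monoˡ-≤ ℚ.∣ x N ∣ {ℚ.∣ x n ℚ.- x N ∣} {1ℚ}
          (ℚ.<⇒≤ (h n N n≥ ℕ.≤-refl))))

  ∣Δ*∣-< : ∀ {a b c d B C δ ε} → 0ℚ ℚ.< B → 0ℚ ℚ.< C → (B ℚ.+ C) ℚ.* δ ≡ ε →
           ℚ.∣ a ∣ ℚ.≤ B → ℚ.∣ d ∣ ℚ.≤ C →
           ℚ.∣ a ℚ.- c ∣ ℚ.< δ → ℚ.∣ b ℚ.- d ∣ ℚ.< δ →
           ℚ.∣ a ℚ.* b ℚ.- c ℚ.* d ∣ ℚ.< ε
  ∣Δ*∣-< {a} {b} {c} {d} {B} {C} {δ} 0<B 0<C eq a≤B d≤C ac<δ bd<δ =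
    subst₂ (λ u v → ℚ.∣ u ∣ ℚ.< v)
      (sym (*-telescope a b c d))
      (trans (sym (ℚ.*-distribʳ-+ δ B C)) eq)
      (∣+∣-< {a ℚ.* (b ℚ.- d)} {d ℚ.* (a ℚ.- c)} {B ℚ.* δ} {C ℚ.* δ}
        (∣*∣-< {a} {b ℚ.- d} {B} {δ} 0<B a≤B bd<δ)
        (∣*∣-< {d} {a ℚ.- c} {C} {δ} 0<C d≤C ac<δ))

  *-cauchy : ∀ {x y} → IsCauchy x → IsCauchy y → IsCauchy (λ n → x n ℚ.* y n)
  *-cauchy {x} {y} cx cy ε 0<ε =
    let B , 0<B , K , hB = bounded {x} cx
        C , 0<C , L , hC = bounded {y} cy
        δ , 0<δ , eq = split (B ℚ.+ C) ε (ℚ.+-mono-< {0ℚ} {B} {0ℚ} {C} 0<B 0<C) 0<ε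
        M , hx = cx δ 0<δ
        N , hy = cy δ 0<δ
    in K ℕ.⊔ L ℕ.⊔ (M ℕ.⊔ N) , λ m n m≥ n≥ →
    let m≥KL = ℕ.m⊔n≤o⇒m≤o (K ℕ.⊔ L) (M ℕ.⊔ N) m≥
        n≥KL = ℕ.m⊔n≤o⇒m≤o (K ℕ.⊔ L) (M ℕ.⊔ N) n≥
        m≥MN = ℕ.m⊔n≤o⇒n≤o (K ℕ.⊔ L) (M ℕ.⊔ N) m≥
        n≥MN = ℕ.m⊔n≤o⇒n≤o (K ℕ.⊔ L) (M ℕ.⊔ N) n≥
    in ∣Δ*∣-< {x m} {y m} {x n} {y n} {B} {C} {δ} {ε} 0<B 0<C eq
         (hB m (ℕ.m⊔n≤o⇒m≤o K L m≥KL)) (hC n (ℕ.m⊔n≤o⇒n≤o K L n≥KL))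
         (hx m n (ℕ.m⊔n≤o⇒m≤o M N m≥MN) (ℕ.m⊔n≤o⇒m≤o M N n≥MN))
         (hy m n (ℕ.m⊔n≤o⇒n≤o M N m≥MN) (ℕ.m⊔n≤o⇒n≤o M N n≥MN))

infixl 6 _+ℝ_
infixl 7 _*ℝ_

_+ℝ_ : ℝ → ℝ → ℝ
(x +ℝ y) .seq n  = seq x n ℚ.+ seq y n
(x +ℝ y) .cauchy = +-cauchy {seq x} {seq y} (cauchy x) (cauchy y)

_*ℝ_ : ℝ → ℝ → ℝ
(x *ℝ y) .seq n  = seq x n ℚ.* seq y n
(x *ℝ y) .cauchy = *-cauchy {seq x} {seq y} (cauchy x) (cauchy y)

{-# OPTIONS --safe #-}
module Submission where

-- Suppose D of positive degree divides all the P i.  By Gauss's lemma D may be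
-- taken integral with integral quotients, so that D(n) divides d_n.  If d_n ≤ k,
-- then either P₁(n) = 0 or D(n) is one of ±1, …, ±⌊k⌋; by the Schwartz–Zippel
-- bound each of these 2⌊k⌋ + 1 equations has at most ℓ #S^(r-1) solutions in S^r.
--
-- Polynomials are handled through the linear functionals x^e ↦ φ e: point masses
-- give the coefficients, monomials give the values, and a product of polynomials
-- becomes an iterated functional.

open import Defs
open import Algebra.Bundles using (CommutativeMonoid; CommutativeRing)
open import Algebra.Definitions.RawMagma using (module _∣ʳ_)
import Algebra.Properties.CommutativeSemigroup
import Algebra.Properties.Semiring.Exp
open import Data.Bool.Base using (if_then_else_)
open import Data.Fin.Base using (Fin; zero; suc)
open import Data.Integer.Base as ℤ using (ℤ; +_; -[1+_]; 0ℤ; 1ℤ)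
import Data.Integer.Divisibility as ℤᵤ
open import Data.Integer.Divisibility.Signed as ℤ using (divides)
import Data.Integer.GCD as ℤ
import Data.Integer.Properties as ℤ
open import Data.Integer.Tactic.RingSolver using (solve-∀)
open import Data.List.Base as List
  using (List; []; _∷_; _++_; map; foldr; filter; length; cartesianProductWith; concatMap; upTo)
open import Data.List.Extrema.Nat using (xs≤max; argmax-sel)
open import Data.List.Membership.Propositional using (_∈_)
open import Data.List.Membership.Propositional.Properties
import Data.List.Properties as List
open import Data.List.Relation.Binary.Subset.Propositional using (_⊆_)
open import Data.List.Relation.Unary.All as All using (All; []; _∷_)
open import Data.List.Relation.Unary.AllPairs using (AllPairs; []; _∷_)
open import Data.List.Relation.Unary.Any as Any using (here; there)
open import Data.List.Relation.Unary.Unique.Propositional using (Unique)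
open import Data.Nat.Base as ℕ using (ℕ; zero; suc; _≤_; NonZero)
import Data.Nat.DivMod as ℕ
import Data.Nat.Divisibility as ℕ
open import Data.Nat.ListAction using (product)
open import Data.Nat.Primality using (Prime; euclidsLemma; prime⇒nonZero)
open import Data.Nat.Primality.Factorisation using (PrimeFactorisation; factorise)
import Data.Nat.Properties as ℕ
import Data.Nat.Tactic.RingSolver as ℕ-Solver
open import Data.Product.Base using (Σ-syntax; ∃-syntax; _×_; _,_; map₁; proj₁; proj₂)
open import Data.Rational.Base as ℚ using (ℚ; mkℚ; 0ℚ; 1ℚ; _/_)
import Data.Rational.Properties as ℚ
import Data.Rational.Solver as ℚ
open import Data.Rational.Unnormalised.Base as ℚᵘ using (mkℚᵘ; *≡*; *≤*; *<*)
import Data.Rational.Unnormalised.Properties as ℚᵘ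
open import Data.Sum.Base using (_⊎_; inj₁; inj₂; [_,_]′)
open import Data.Vec.Base as Vec using (Vec; []; _∷_)
import Data.Vec.Functional as Vector
import Data.Vec.Properties as Vec
open import Function.Base using (_∘_; id)
open import Function.Bundles using (Equivalence)
open import Relation.Binary.Definitions using (tri<; tri≈; tri>)
import Relation.Binary.Definitions as Binary
open import Relation.Binary.PropositionalEquality as ≡
  using (_≡_; _≢_; refl; sym; trans; cong; cong₂; subst; subst₂)
import Relation.Binary.Reasoning.Setoid
open import Relation.Nullary.Decidable using (does; yes; no; ¬?; dec-yes)
open import Relation.Nullary.Negation.Core using (¬_; contradiction)
open import Relation.Unary using (Pred; Decidable)

open Algebra.Properties.Semiring.Exp (CommutativeRing.semiring ℤ.+-*-commutativeRing)
  using (_^_; ^-homo-*)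
open Algebra.Properties.CommutativeSemigroup ℤ.*-commutativeSemigroup
  using () renaming (interchange to *-interchange)
open Algebra.Properties.CommutativeSemigroup
  (CommutativeMonoid.commutativeSemigroup ℚ.*-1-commutativeMonoid)
  using () renaming (x∙yz≈y∙xz to p*qr≡q*pr)

-- Linear functionals on polynomials

-- Integrality is what makes the covering finite: a rational D could take fractional values, and
-- then d_n ≤ k would not confine D(n) to a fixed finite set. The summand 1 in 2k + 1 pays for the
-- zeros of P₁, which include every point with d_n = 0; the summand 2k pays for the nonzero values
-- of D. Two obstacles shape the details. A `Poly` is an unnormalised list of terms, so neither its
-- degree nor its leading term can be read off. The record `Leading n` recovers a leading term after
-- discarding multiples of `n`, and one argument about products of leading terms then serves for
-- degrees (`n = 0`) and for Gauss's lemma (`n` prime). Further, `k` is a Cauchy sequence, from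
-- which ⌊k⌋ cannot be computed. Its place is taken by an integer `K` that bounds all natural
-- numbers up to `k` but may exceed ⌊k⌋. The strict hypothesis provides a rational gap, and `K`
-- comes from an approximation of `k` fine enough for (2K + 1) ℓ / #S to stay below the density.

module Functionals {c ℓ} (R : CommutativeRing c ℓ)
                   (_≟_ : Binary.Decidable (CommutativeRing._≈_ R)) where

  open CommutativeRing R hiding (zero)
    renaming (refl to ≈-refl; sym to ≈-sym; trans to ≈-trans)
  open Polynomial R _≟_
  open Relation.Binary.Reasoning.Setoid setoid
  open Algebra.Properties.CommutativeSemigroup *-commutativeSemigroup using (x∙yz≈y∙xz)

  ⟦_⟧ : ∀ {r} → Poly r → (Vec ℕ r → Carrier) → Carrier
  ⟦ []          ⟧ φ = 0#
  ⟦ (a , e) ∷ p ⟧ φ = a * φ e + ⟦ p ⟧ φ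

  δ : ∀ {r} → Vec ℕ r → Vec ℕ r → Carrier
  δ e d = if does (Vec.≡-dec ℕ._≟_ d e) then 1# else 0#

  scale : ∀ {r} → Carrier → Poly r → Poly r
  scale c = map (map₁ (c *_))

  δ-refl : ∀ {r} (e : Vec ℕ r) → δ e e ≡ 1#
  δ-refl e rewrite proj₂ (dec-yes (Vec.≡-dec ℕ._≟_ e e) refl) = refl

  δ-≢ : ∀ {r} {d e : Vec ℕ r} → ¬ d ≡ e → δ e d ≡ 0#
  δ-≢ {d = d} {e} d≢e with Vec.≡-dec ℕ._≟_ d e
  ... | yes d≡e = contradiction d≡e d≢e
  ... | no  _   = refl

  coeff-⟦⟧ : ∀ {r} (p : Poly r) e → coeff p e ≈ ⟦ p ⟧ (δ e)
  coeff-⟦⟧ []            e = ≈-refl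
  coeff-⟦⟧ ((a , d) ∷ p) e with Vec.≡-dec ℕ._≟_ d e
  ... | yes _ = +-cong (≈-sym (*-identityʳ a)) (coeff-⟦⟧ p e)
  ... | no  _ = begin
    coeff p e                ≈⟨ coeff-⟦⟧ p e ⟩
    ⟦ p ⟧ (δ e)              ≈⟨ +-identityˡ _ ⟨
    0# + ⟦ p ⟧ (δ e)         ≈⟨ +-congʳ (zeroʳ a) ⟨
    a * 0# + ⟦ p ⟧ (δ e)     ∎

  ⟦⟧-cong : ∀ {r} (p : Poly r) {φ ψ} → (∀ e → φ e ≈ ψ e) → ⟦ p ⟧ φ ≈ ⟦ p ⟧ ψ
  ⟦⟧-cong []            φ≈ψ = ≈-refl
  ⟦⟧-cong ((a , e) ∷ p) φ≈ψ = +-cong (*-congˡ (φ≈ψ e)) (⟦⟧-cong p φ≈ψ)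

  ⟦⟧-homo-* : ∀ {r} (p : Poly r) c φ → ⟦ p ⟧ (λ e → c * φ e) ≈ c * ⟦ p ⟧ φ
  ⟦⟧-homo-* []            c φ = ≈-sym (zeroʳ c)
  ⟦⟧-homo-* ((a , e) ∷ p) c φ = begin
    a * (c * φ e) + ⟦ p ⟧ (λ e → c * φ e)  ≈⟨ +-cong (x∙yz≈y∙xz a c _) (⟦⟧-homo-* p c φ) ⟩
    c * (a * φ e) + c * ⟦ p ⟧ φ            ≈⟨ distribˡ c _ _ ⟨
    c * (a * φ e + ⟦ p ⟧ φ)                ∎

  ⟦++⟧ : ∀ {r} (p q : Poly r) φ → ⟦ p ++ q ⟧ φ ≈ ⟦ p ⟧ φ + ⟦ q ⟧ φ
  ⟦++⟧ []            q φ = ≈-sym (+-identityˡ _)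
  ⟦++⟧ ((a , e) ∷ p) q φ = ≈-trans (+-congˡ (⟦++⟧ p q φ)) (≈-sym (+-assoc _ _ _))

  ⟦scale⟧ : ∀ {r} c (p : Poly r) φ → ⟦ scale c p ⟧ φ ≈ c * ⟦ p ⟧ φ
  ⟦scale⟧ c []            φ = ≈-sym (zeroʳ c)
  ⟦scale⟧ c ((a , e) ∷ p) φ =
    ≈-trans (+-cong (*-assoc c a _) (⟦scale⟧ c p φ)) (≈-sym (distribˡ c _ _))

  ⟦*ₚ⟧ : ∀ {r} (p q : Poly r) φ →
         ⟦ p *ₚ q ⟧ φ ≈ ⟦ p ⟧ (λ d → ⟦ q ⟧ (λ e → φ (Vec.zipWith ℕ._+_ d e)))
  ⟦*ₚ⟧ []            q φ = ≈-refl
  ⟦*ₚ⟧ ((a , d) ∷ p) q φ =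
    ≈-trans (⟦++⟧ (map _ q) (p *ₚ q) φ) (+-cong (monomial q) (⟦*ₚ⟧ p q φ))
    where
    monomial : ∀ q →
      ⟦ map (λ (b , e) → a * b , Vec.zipWith ℕ._+_ d e) q ⟧ φ ≈
      a * ⟦ q ⟧ (λ e → φ (Vec.zipWith ℕ._+_ d e))
    monomial []            = ≈-sym (zeroʳ a)
    monomial ((b , e) ∷ q) =
      ≈-trans (+-cong (*-assoc a b _) (monomial q)) (≈-sym (distribˡ a _ _))

  coeff≉0⇒∈exponents : ∀ {r} (p : Poly r) {e} → ¬ coeff p e ≈ 0# → e ∈ map proj₂ p
  coeff≉0⇒∈exponents []            c≉0 = contradiction ≈-refl c≉0
  coeff≉0⇒∈exponents ((a , d) ∷ p) {e} c≉0 with Vec.≡-dec ℕ._≟_ d e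
  ... | yes d≡e = here (sym d≡e)
  ... | no  _   = there (coeff≉0⇒∈exponents p c≉0)

  coeff≉0⇒sum≤deg : ∀ {r} (p : Poly r) {e} → ¬ coeff p e ≈ 0# → Vec.sum e ℕ.≤ deg p
  coeff≉0⇒sum≤deg p c≉0 = All.lookup (xs≤max 0 _)
    (∈-map⁺ Vec.sum (∈-filter⁺ (λ e → ¬? (coeff p e ≟ 0#)) (coeff≉0⇒∈exponents p c≉0) c≉0))

  0<deg⇒coeff≉0 : ∀ {r} (p : Poly r) → 0 ℕ.< deg p → ∃[ e ] 0 ℕ.< Vec.sum e × ¬ coeff p e ≈ 0#
  0<deg⇒coeff≉0 p 0<deg
    with argmax-sel id 0 (map Vec.sum (filter (λ e → ¬? (coeff p e ≟ 0#)) (map proj₂ p)))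
  ... | inj₁ deg≡0 = contradiction (sym deg≡0) (ℕ.<⇒≢ 0<deg)
  ... | inj₂ deg∈  with e , e∈ , deg≡ ← ∈-map⁻ Vec.sum deg∈ =
    e , subst (0 ℕ.<_) deg≡ 0<deg ,
    proj₂ (∈-filter⁻ (λ e → ¬? (coeff p e ≟ 0#)) {xs = map proj₂ p} e∈)

open ℤ[X] using (Poly; coeff; eval; deg; _*ₚ_; _≈ₚ_; 0ₚ)
open Functionals ℤ.+-*-commutativeRing ℤ._≟_
module ℚF = Functionals ℚ.+-*-commutativeRing ℚ._≟_

-- The graded lexicographic order on exponents

infixl 6 _⊕_

_⊕_ : ∀ {r} → Vec ℕ r → Vec ℕ r → Vec ℕ r
_⊕_ = Vec.zipWith ℕ._+_

infix 4 _<ₗ_ _≺_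

data _<ₗ_ : ∀ {r} → Vec ℕ r → Vec ℕ r → Set where
  here  : ∀ {r x y} {d e : Vec ℕ r} → x ℕ.< y → x ∷ d <ₗ y ∷ e
  there : ∀ {r x} {d e : Vec ℕ r} → d <ₗ e → x ∷ d <ₗ x ∷ e

-- With the total degree prepended, the graded order is a lexicographic order and inherits its
-- properties. Comparing total degrees first makes the leading exponent carry the degree.
graded : ∀ {r} → Vec ℕ r → Vec ℕ (suc r)
graded d = Vec.sum d ∷ d

_≺_ : ∀ {r} → Vec ℕ r → Vec ℕ r → Set
d ≺ e = graded d <ₗ graded e

<ₗ-irrefl : ∀ {r} {d : Vec ℕ r} → ¬ d <ₗ d
<ₗ-irrefl (here x<x)  = ℕ.<-irrefl refl x<x
<ₗ-irrefl (there d<d) = <ₗ-irrefl d<d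

<ₗ-trans : ∀ {r} {d e f : Vec ℕ r} → d <ₗ e → e <ₗ f → d <ₗ f
<ₗ-trans (here x<y)  (here y<z)  = here (ℕ.<-trans x<y y<z)
<ₗ-trans (here x<y)  (there _)   = here x<y
<ₗ-trans (there _)   (here y<z)  = here y<z
<ₗ-trans (there d<e) (there e<f) = there (<ₗ-trans d<e e<f)

<ₗ-connex : ∀ {r} (d e : Vec ℕ r) → d <ₗ e ⊎ d ≡ e ⊎ e <ₗ d
<ₗ-connex []      []      = inj₂ (inj₁ refl)
<ₗ-connex (x ∷ d) (y ∷ e) with ℕ.<-cmp x y
... | tri< x<y _ _ = inj₁ (here x<y)
... | tri> _ _ y<x = inj₂ (inj₂ (here y<x))
... | tri≈ _ refl _ with <ₗ-connex d e
...   | inj₁ d<e         = inj₁ (there d<e)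
...   | inj₂ (inj₁ refl) = inj₂ (inj₁ refl)
...   | inj₂ (inj₂ e<d)  = inj₂ (inj₂ (there e<d))

⊕-monoʳ-<ₗ : ∀ {r} (f : Vec ℕ r) {d e} → d <ₗ e → f ⊕ d <ₗ f ⊕ e
⊕-monoʳ-<ₗ (x ∷ f) (here y<z)  = here (ℕ.+-monoʳ-< x y<z)
⊕-monoʳ-<ₗ (x ∷ f) (there d<e) = there (⊕-monoʳ-<ₗ f d<e)

sum-⊕ : ∀ {r} (d e : Vec ℕ r) → Vec.sum (d ⊕ e) ≡ Vec.sum d ℕ.+ Vec.sum e
sum-⊕ []      []      = refl
sum-⊕ (x ∷ d) (y ∷ e) rewrite sum-⊕ d e = interchange x y (Vec.sum d) (Vec.sum e)
  where
  open import Algebra.Properties.CommutativeSemigroup ℕ.+-commutativeSemigroup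
    using (interchange)

⊕-comm : ∀ {r} (d e : Vec ℕ r) → d ⊕ e ≡ e ⊕ d
⊕-comm = Vec.zipWith-comm ℕ.+-comm

graded-⊕ : ∀ {r} (d e : Vec ℕ r) → graded (d ⊕ e) ≡ graded d ⊕ graded e
graded-⊕ d e = cong (_∷ d ⊕ e) (sum-⊕ d e)

⊕-monoʳ-≺ : ∀ {r} (f : Vec ℕ r) {d e} → d ≺ e → f ⊕ d ≺ f ⊕ e
⊕-monoʳ-≺ f {d} {e} d≺e = subst₂ _<ₗ_ (sym (graded-⊕ f d)) (sym (graded-⊕ f e))
  (⊕-monoʳ-<ₗ (graded f) d≺e)

⊕-monoˡ-≺ : ∀ {r} (f : Vec ℕ r) {d e} → d ≺ e → d ⊕ f ≺ e ⊕ f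
⊕-monoˡ-≺ f {d} {e} d≺e = subst₂ _≺_ (⊕-comm f d) (⊕-comm f e) (⊕-monoʳ-≺ f d≺e)

≺⇒≢ : ∀ {r} {d e : Vec ℕ r} → d ≺ e → ¬ d ≡ e
≺⇒≢ d≺d refl = <ₗ-irrefl d≺d

≺-connex : ∀ {r} (d e : Vec ℕ r) → d ≺ e ⊎ d ≡ e ⊎ e ≺ d
≺-connex d e with <ₗ-connex (graded d) (graded e)
... | inj₁ d≺e       = inj₁ d≺e
... | inj₂ (inj₁ eq) = inj₂ (inj₁ (Vec.∷-injectiveʳ eq))
... | inj₂ (inj₂ e≺d) = inj₂ (inj₂ e≺d)

≺⇒sum≤ : ∀ {r} {d e : Vec ℕ r} → d ≺ e → Vec.sum d ℕ.≤ Vec.sum e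
≺⇒sum≤ = head≤
  where
  head≤ : ∀ {r x y} {d e : Vec ℕ r} → x ∷ d <ₗ y ∷ e → x ℕ.≤ y
  head≤ (here x<y) = ℕ.<⇒≤ x<y
  head≤ (there _)  = ℕ.≤-refl

-- Leading terms modulo an integer

infix 4 _≋_

-- `_≈ₚ_` tests point masses only. Testing every functional makes equality pass at once to values
-- and to the factors of a product; `≈ₚ⇒≋` recovers this form from equality of coefficients.
_≋_ : ∀ {r} → Poly r → Poly r → Set
p ≋ q = ∀ φ → ⟦ p ⟧ φ ≡ ⟦ q ⟧ φ

Sorted : ∀ {r} → Poly r → Set
Sorted = AllPairs (λ s t → proj₂ t ≺ proj₂ s)

-- A merged coefficient may be 0 and stays in the list. This is harmless: every integer divides 0,
-- so `leading?` passes over such a term.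
insert : ∀ {r} → ℤ × Vec ℕ r → Poly r → Poly r
insert (a , d) []            = (a , d) ∷ []
insert (a , d) ((b , e) ∷ p) with ≺-connex d e
... | inj₁ _        = (b , e) ∷ insert (a , d) p
... | inj₂ (inj₁ _) = (a ℤ.+ b , e) ∷ p
... | inj₂ (inj₂ _) = (a , d) ∷ (b , e) ∷ p

sort : ∀ {r} → Poly r → Poly r
sort = foldr insert []

⟦insert⟧ : ∀ {r} a d (p : Poly r) φ → ⟦ insert (a , d) p ⟧ φ ≡ a ℤ.* φ d ℤ.+ ⟦ p ⟧ φ
⟦insert⟧ a d []            φ = refl
⟦insert⟧ a d ((b , e) ∷ p) φ with ≺-connex d e
... | inj₁ _           = trans
  (cong (λ x → b ℤ.* φ e ℤ.+ x) (⟦insert⟧ a d p φ))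
  (swap (b ℤ.* φ e) (a ℤ.* φ d) (⟦ p ⟧ φ))
  where
  swap : ∀ x y z → x ℤ.+ (y ℤ.+ z) ≡ y ℤ.+ (x ℤ.+ z)
  swap = solve-∀
... | inj₂ (inj₁ refl) = merge a b (φ d) (⟦ p ⟧ φ)
  where
  merge : ∀ a b x y → (a ℤ.+ b) ℤ.* x ℤ.+ y ≡ a ℤ.* x ℤ.+ (b ℤ.* x ℤ.+ y)
  merge = solve-∀
... | inj₂ (inj₂ _)    = refl

⟦sort⟧ : ∀ {r} (p : Poly r) → p ≋ sort p
⟦sort⟧ []            φ = refl
⟦sort⟧ ((a , e) ∷ p) φ =
  trans (cong (λ x → a ℤ.* φ e ℤ.+ x) (⟦sort⟧ p φ)) (sym (⟦insert⟧ a e (sort p) φ))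

insert-All : ∀ {r} {Q : Vec ℕ r → Set} a {d} → Q d → ∀ p →
             All (λ t → Q (proj₂ t)) p → All (λ t → Q (proj₂ t)) (insert (a , d) p)
insert-All a     qd []            []        = qd ∷ []
insert-All a {d} qd ((b , e) ∷ p) (qe ∷ qp) with ≺-connex d e
... | inj₁ _        = qe ∷ insert-All a qd p qp
... | inj₂ (inj₁ _) = qe ∷ qp
... | inj₂ (inj₂ _) = qd ∷ qe ∷ qp

insert-Sorted : ∀ {r} a d (p : Poly r) → Sorted p → Sorted (insert (a , d) p)
insert-Sorted a d []            []        = [] ∷ []
insert-Sorted a d ((b , e) ∷ p) (p≺e ∷ s) with ≺-connex d e
... | inj₁ d≺e        = insert-All a d≺e p p≺e ∷ insert-Sorted a d p s
... | inj₂ (inj₁ _)   = p≺e ∷ s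
... | inj₂ (inj₂ e≺d) = (e≺d ∷ All.map (λ f≺e → <ₗ-trans f≺e e≺d) p≺e) ∷ p≺e ∷ s

sort-Sorted : ∀ {r} (p : Poly r) → Sorted (sort p)
sort-Sorted []            = []
sort-Sorted ((a , e) ∷ p) = insert-Sorted a e (sort p) (sort-Sorted p)

-- A leading term modulo `n`: the ordinary one for `n = 0`, that of the reduction modulo `n` for a
-- prime. Keeping `multiple` as a polynomial turns the congruence into an equality that any
-- functional can test.
record Leading {r} (n : ℤ) (p : Poly r) : Set where
  field
    exponent      : Vec ℕ r
    coefficient   : ℤ
    multiple      : Poly r
    tail          : Poly r
    decomposition : ∀ φ → ⟦ p ⟧ φ ≡
                    n ℤ.* ⟦ multiple ⟧ φ ℤ.+ (coefficient ℤ.* φ exponent ℤ.+ ⟦ tail ⟧ φ)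
    tail≺         : All (λ t → proj₂ t ≺ exponent) tail
    indivisible   : ¬ n ℤ.∣ coefficient

leading? : ∀ {r} n (p : Poly r) → (Σ[ q ∈ Poly r ] ∀ φ → ⟦ p ⟧ φ ≡ n ℤ.* ⟦ q ⟧ φ) ⊎ Leading n p
leading? n p = [ (λ (q , eq) → inj₁ (q , λ φ → trans (⟦sort⟧ p φ) (eq φ)))
               , (λ l → let open Leading l in inj₂ record
                   { Leading l
                   ; decomposition = λ φ → trans (⟦sort⟧ p φ) (decomposition φ) })
               ]′ (go (sort p) (sort-Sorted p))
  where
  carry : ∀ q n x y z → q ℤ.* n ℤ.* x ℤ.+ (n ℤ.* y ℤ.+ z) ≡ n ℤ.* (q ℤ.* x ℤ.+ y) ℤ.+ z
  carry = solve-∀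
  carry₀ : ∀ q n x y → q ℤ.* n ℤ.* x ℤ.+ n ℤ.* y ≡ n ℤ.* (q ℤ.* x ℤ.+ y)
  carry₀ = solve-∀
  -- While the leading coefficient is divisible by n, move that term to the multiple.
  go : ∀ p → Sorted p → (Σ[ q ∈ Poly _ ] ∀ φ → ⟦ p ⟧ φ ≡ n ℤ.* ⟦ q ⟧ φ) ⊎ Leading n p
  go []            []        = inj₁ ([] , λ _ → sym (ℤ.*-zeroʳ n))
  go ((a , e) ∷ p) (p≺e ∷ s) with n ℤ.∣? a
  ... | no n∤a = inj₂ record
    { exponent = e ; coefficient = a ; multiple = [] ; tail = p
    ; decomposition = λ φ → sym (trans (cong (ℤ._+ _) (ℤ.*-zeroʳ n)) (ℤ.+-identityˡ _))
    ; tail≺ = p≺e ; indivisible = n∤a }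
  ... | yes (divides c refl) with go p s
  ...   | inj₁ (q , eq) = inj₁ ((c , e) ∷ q , λ φ →
          trans (cong (λ x → c ℤ.* n ℤ.* φ e ℤ.+ x) (eq φ)) (carry₀ c n (φ e) (⟦ q ⟧ φ)))
  ...   | inj₂ l = inj₂ record
          { Leading l
          ; multiple = (c , e) ∷ Leading.multiple l
          ; decomposition = λ φ →
              trans (cong (λ x → c ℤ.* n ℤ.* φ e ℤ.+ x) (Leading.decomposition l φ))
                    (carry c n (φ e) (⟦ Leading.multiple l ⟧ φ) _) }

∣⟦⟧ : ∀ {r n} (p : Poly r) φ → All (λ t → n ℤ.∣ φ (proj₂ t)) p → n ℤ.∣ ⟦ p ⟧ φ
∣⟦⟧ []            φ []        = divides 0ℤ refl
∣⟦⟧ ((a , e) ∷ p) φ (n∣ ∷ ns) = ℤ.∣m∣n⇒∣m+n (ℤ.∣n⇒∣m*n a n∣) (∣⟦⟧ p φ ns)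

∣m-n∣n⇒∣m : ∀ {i m n} → i ℤ.∣ m ℤ.- n → i ℤ.∣ n → i ℤ.∣ m
∣m-n∣n⇒∣m {i} {m} {n} i∣m-n i∣n = ℤ.∣m+n∣n⇒∣m {i} {m} {ℤ.- n} i∣m-n (ℤ.∣m⇒∣-m i∣n)

∣m-n∣m⇒∣n : ∀ {i m n} → i ℤ.∣ m ℤ.- n → i ℤ.∣ m → i ℤ.∣ n
∣m-n∣m⇒∣n {i} {m} {n} i∣m-n i∣m = subst (i ℤ.∣_) (cancel m n) (ℤ.∣m∣n⇒∣m-n i∣m i∣m-n)
  where
  cancel : ∀ x y → x ℤ.- (x ℤ.- y) ≡ y
  cancel = solve-∀

module _ {r n} {p : Poly r} (l : Leading n p) where
  open Leading l

  -- The tail lies where `φ` vanishes modulo `n`, so only the leading term contributes. With a point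
  -- mass for `φ` this reads off a coefficient; with the functional induced by a second factor it
  -- treats products.
  leading-mod : ∀ φ → (∀ {e} → e ≺ exponent → n ℤ.∣ φ e) →
                n ℤ.∣ ⟦ p ⟧ φ ℤ.- coefficient ℤ.* φ exponent
  leading-mod φ n∣φ = subst (n ℤ.∣_) (sym eq)
    (ℤ.∣m∣n⇒∣m+n (ℤ.∣m⇒∣m*n (⟦ multiple ⟧ φ) ℤ.∣-refl) (∣⟦⟧ tail φ (All.map n∣φ tail≺)))
    where
    cancel : ∀ x y z → x ℤ.+ (y ℤ.+ z) ℤ.- y ≡ x ℤ.+ z
    cancel = solve-∀
    eq : ⟦ p ⟧ φ ℤ.- coefficient ℤ.* φ exponent ≡ n ℤ.* ⟦ multiple ⟧ φ ℤ.+ ⟦ tail ⟧ φ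
    eq = trans (cong (ℤ._- coefficient ℤ.* φ exponent) (decomposition φ))
               (cancel (n ℤ.* ⟦ multiple ⟧ φ) (coefficient ℤ.* φ exponent) (⟦ tail ⟧ φ))

  leading-coeff : ¬ n ℤ.∣ coeff p exponent
  leading-coeff n∣c = indivisible (∣m-n∣m⇒∣n
    (subst (λ x → n ℤ.∣ ⟦ p ⟧ (δ exponent) ℤ.- x)
      (trans (cong (coefficient ℤ.*_) (δ-refl exponent)) (ℤ.*-identityʳ _))
      (leading-mod (δ exponent) (λ e≺ → divides 0ℤ (δ-≢ (≺⇒≢ e≺)))))
    (subst (n ℤ.∣_) (coeff-⟦⟧ p exponent) n∣c))

-- Both 0 and primes satisfy this, so the same argument yields additivity of
-- degrees and Gauss's lemma.

EuclidsLemma : ℤ → Set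
EuclidsLemma n = ∀ a b → n ℤ.∣ a ℤ.* b → n ℤ.∣ a ⊎ n ℤ.∣ b

module _ {r n} (euclid : EuclidsLemma n) {p q : Poly r}
         (lp : Leading n p) (lq : Leading n q) where
  private
    open Leading
    d = exponent lp
    e = exponent lq
    b = coefficient lq

    φ : Vec ℕ r → Vec ℕ r → ℤ
    φ x y = δ (d ⊕ e) (x ⊕ y)

    φ≺ : ∀ {x y} → x ⊕ y ≺ d ⊕ e → n ℤ.∣ φ x y
    φ≺ xy≺de = divides 0ℤ (δ-≢ (≺⇒≢ xy≺de))

    inner : ∀ {x} → x ≺ d → n ℤ.∣ ⟦ q ⟧ (φ x)
    inner {x} x≺d = ∣m-n∣n⇒∣m
      (leading-mod lq (φ x)
        (λ y≺e → φ≺ (<ₗ-trans (⊕-monoʳ-≺ x y≺e) (⊕-monoˡ-≺ e x≺d))))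
      (ℤ.∣n⇒∣m*n b (φ≺ (⊕-monoˡ-≺ e x≺d)))

    inner-top : n ℤ.∣ ⟦ q ⟧ (φ d) ℤ.- b
    inner-top = subst (λ x → n ℤ.∣ ⟦ q ⟧ (φ d) ℤ.- x)
      (trans (cong (b ℤ.*_) (δ-refl (d ⊕ e))) (ℤ.*-identityʳ b))
      (leading-mod lq (φ d) (λ y≺e → φ≺ (⊕-monoʳ-≺ d y≺e)))

  -- Among exponents x up to `d` and y up to `e`, only x = `d`, y = `e` give x ⊕ y = `d ⊕ e`. Modulo
  -- `n` the coefficient there is therefore the product of the two leading coefficients, and
  -- Euclid's lemma keeps it indivisible.
  leading-product : ¬ n ℤ.∣ ⟦ p *ₚ q ⟧ (δ (d ⊕ e))
  leading-product n∣pq =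
    [ indivisible lp , (λ n∣q → indivisible lq (∣m-n∣m⇒∣n inner-top n∣q)) ]′
      (euclid (coefficient lp) (⟦ q ⟧ (φ d))
        (∣m-n∣m⇒∣n (leading-mod lp (λ x → ⟦ q ⟧ (φ x)) inner)
          (subst (n ℤ.∣_) (⟦*ₚ⟧ p q (δ (d ⊕ e))) n∣pq)))

-- Either every functional kills the difference, or the difference has a leading term modulo 0,
-- hence a coefficient not divisible by 0, that is, a nonzero one.
≈ₚ⇒≋ : ∀ {r} {p q : Poly r} → p ≈ₚ q → p ≋ q
≈ₚ⇒≋ {r} {p} {q} p≈q φ = [ (λ (_ , eq) → ℤ.i-j≡0⇒i≡j _ _ (trans (sym (⟦p-q⟧ φ)) (eq φ)))
                         , (λ l → contradiction (divides 0ℤ (coeff≡0 _)) (leading-coeff l))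
                         ]′ (leading? 0ℤ p-q)
  where
  p-q : Poly r
  p-q = p ++ scale ℤ.-1ℤ q
  ⟦p-q⟧ : ∀ φ → ⟦ p-q ⟧ φ ≡ ⟦ p ⟧ φ ℤ.- ⟦ q ⟧ φ
  ⟦p-q⟧ φ = trans (⟦++⟧ p _ φ) (cong (λ x → ⟦ p ⟧ φ ℤ.+ x)
    (trans (⟦scale⟧ ℤ.-1ℤ q φ) (ℤ.-1*i≡-i _)))
  coeff≡0 : ∀ e → coeff p-q e ≡ 0ℤ
  coeff≡0 e = trans (coeff-⟦⟧ p-q e) (trans (⟦p-q⟧ (δ e)) (ℤ.i≡j⇒i-j≡0
    (trans (sym (coeff-⟦⟧ p e)) (trans (p≈q e) (coeff-⟦⟧ q e)))))

euclid-prime : ∀ {p} → Prime p → EuclidsLemma (+ p)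
euclid-prime pr a b p∣ab =
  [ (λ x → inj₁ (ℤ.∣ᵤ⇒∣ x)) , (λ x → inj₂ (ℤ.∣ᵤ⇒∣ x)) ]′
    (euclidsLemma ℤ.∣ a ∣ ℤ.∣ b ∣ pr (subst (_ ℕ.∣_) (ℤ.abs-* a b) (ℤ.∣⇒∣ᵤ p∣ab)))

euclid-0 : EuclidsLemma 0ℤ
euclid-0 a b 0∣ab = [ (λ a≡0 → inj₁ (divides 0ℤ a≡0)) , (λ b≡0 → inj₂ (divides 0ℤ b≡0)) ]′
  (ℤ.i*j≡0⇒i≡0∨j≡0 a (ℤ.0∣⇒≡0 0∣ab))

⟦*ₚ⟧-scaleʳ : ∀ {r} c (p : Poly r) {q q′ : Poly r} →
             (∀ φ → ⟦ q ⟧ φ ≡ c ℤ.* ⟦ q′ ⟧ φ) →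
             ∀ φ → ⟦ p *ₚ q ⟧ φ ≡ c ℤ.* ⟦ p *ₚ q′ ⟧ φ
⟦*ₚ⟧-scaleʳ c p {q} {q′} eq φ =
  trans (⟦*ₚ⟧ p q φ) (trans (⟦⟧-cong p (λ d → eq _))
    (trans (⟦⟧-homo-* p c _) (cong (c ℤ.*_) (sym (⟦*ₚ⟧ p q′ φ)))))

⟦*ₚ⟧-scaleˡ : ∀ {r} c {p p′ : Poly r} (q : Poly r) →
             (∀ φ → ⟦ p ⟧ φ ≡ c ℤ.* ⟦ p′ ⟧ φ) →
             ∀ φ → ⟦ p *ₚ q ⟧ φ ≡ c ℤ.* ⟦ p′ *ₚ q ⟧ φ
⟦*ₚ⟧-scaleˡ c {p} {p′} q eq φ =
  trans (⟦*ₚ⟧ p q φ) (trans (eq _) (cong (c ℤ.*_) (sym (⟦*ₚ⟧ p′ q φ))))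

-- Gauss's lemma: the primes are cancelled one at a time from m P = Q D, each
-- dividing D or all the Q i.

gauss : ∀ {r s} ps → All Prime ps → (P Q : Fin s → Poly r) (D : Poly r) →
        (∀ i φ → ⟦ Q i *ₚ D ⟧ φ ≡ + product ps ℤ.* ⟦ P i ⟧ φ) →
        Σ[ D′ ∈ Poly r ] Σ[ Q′ ∈ (Fin s → Poly r) ]
          (∀ i → Q′ i *ₚ D′ ≋ P i) × ∃[ m ] (∀ φ → ⟦ D ⟧ φ ≡ m ℤ.* ⟦ D′ ⟧ φ)
gauss []       []         P Q D QD≡ =
  D , Q , (λ i φ → trans (QD≡ i φ) (ℤ.*-identityˡ _)) , 1ℤ , λ φ → sym (ℤ.*-identityˡ _)
gauss (p ∷ ps) (pr ∷ prs) P Q D QD≡ = descend (leading? (+ p) D)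
  where
  Result = Σ[ D′ ∈ Poly _ ] Σ[ Q′ ∈ (Fin _ → Poly _) ]
    (∀ i → Q′ i *ₚ D′ ≋ P i) × ∃[ m ] (∀ φ → ⟦ D ⟧ φ ≡ m ℤ.* ⟦ D′ ⟧ φ)

  p*-assoc : ∀ x → + (p ℕ.* product ps) ℤ.* x ≡ + p ℤ.* (+ product ps ℤ.* x)
  p*-assoc x = trans (cong (ℤ._* x) (ℤ.pos-* p (product ps))) (ℤ.*-assoc (+ p) _ x)

  cancel : ∀ {x y} → + p ℤ.* x ≡ + (p ℕ.* product ps) ℤ.* y → x ≡ + product ps ℤ.* y
  cancel {x} {y} eq =
    ℤ.*-cancelˡ-≡ (+ p) x _ {{prime⇒nonZero pr}} (trans eq (p*-assoc y))

  -- The split is on `D` alone, so that the prime leaves all products in the same way: once from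
  -- `D`, or from every `Q i`. The factor `m` records what `D` loses; through it a nonzero
  -- coefficient of `D` stays nonzero in `D′`.
  descend : (Σ[ q ∈ Poly _ ] ∀ φ → ⟦ D ⟧ φ ≡ + p ℤ.* ⟦ q ⟧ φ) ⊎ Leading (+ p) D → Result
  descend (inj₁ (D₁ , D≡))
    with D′ , Q′ , Q′D′≋P , m , D₁≡ ← gauss ps prs P Q D₁ (λ i φ →
      cancel (trans (sym (⟦*ₚ⟧-scaleʳ (+ p) (Q i) {D} {D₁} D≡ φ)) (QD≡ i φ)))
    = D′ , Q′ , Q′D′≋P , + p ℤ.* m , λ φ →
      trans (D≡ φ) (trans (cong (+ p ℤ.*_) (D₁≡ φ)) (sym (ℤ.*-assoc (+ p) m _)))
  descend (inj₂ lD) = gauss ps prs P (λ i → proj₁ (Q₁ i)) D (λ i φ →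
      cancel (trans (sym (⟦*ₚ⟧-scaleˡ (+ p) {Q i} {proj₁ (Q₁ i)} D (proj₂ (Q₁ i)) φ)) (QD≡ i φ)))
    where
    Q₁ : ∀ i → Σ[ q ∈ Poly _ ] ∀ φ → ⟦ Q i ⟧ φ ≡ + p ℤ.* ⟦ q ⟧ φ
    Q₁ i with leading? (+ p) (Q i)
    ... | inj₁ q  = q
    -- With leading terms modulo `p` in both factors, the product would have a coefficient
    -- indivisible by `p`.
    ... | inj₂ lQ = contradiction
      (subst (+ p ℤ.∣_) (sym (trans (QD≡ i _) (p*-assoc _))) (ℤ.∣m⇒∣m*n _ ℤ.∣-refl))
      (leading-product (euclid-prime pr) lQ lD)

-- Values

monomial : ∀ {r} → Vec ℤ r → Vec ℕ r → ℤ
monomial x e = Vec.foldr′ ℤ._*_ 1ℤ (Vec.zipWith _^_ x e)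

eval-⟦⟧ : ∀ {r} (p : Poly r) x → eval p x ≡ ⟦ p ⟧ (monomial x)
eval-⟦⟧ []            x = refl
eval-⟦⟧ ((a , e) ∷ p) x = cong (λ y → a ℤ.* monomial x e ℤ.+ y) (eval-⟦⟧ p x)

eval-cong : ∀ {r} {p q : Poly r} → p ≋ q → ∀ x → eval p x ≡ eval q x
eval-cong {p = p} {q} p≋q x =
  trans (eval-⟦⟧ p x) (trans (p≋q (monomial x)) (sym (eval-⟦⟧ q x)))

monomial-⊕ : ∀ {r} (x : Vec ℤ r) d e → monomial x (d ⊕ e) ≡ monomial x d ℤ.* monomial x e
monomial-⊕ []      []      []      = refl
monomial-⊕ (x ∷ xs) (i ∷ d) (j ∷ e) =
  trans (cong₂ ℤ._*_ (^-homo-* x i j) (monomial-⊕ xs d e))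
        (*-interchange (x ^ i) (x ^ j) (monomial xs d) (monomial xs e))

eval-*ₚ : ∀ {r} (p q : Poly r) x → eval (p *ₚ q) x ≡ eval p x ℤ.* eval q x
eval-*ₚ p q x = begin
  eval (p *ₚ q) x                             ≡⟨ eval-⟦⟧ (p *ₚ q) x ⟩
  ⟦ p *ₚ q ⟧ μ                                ≡⟨ ⟦*ₚ⟧ p q μ ⟩
  ⟦ p ⟧ (λ d → ⟦ q ⟧ (λ e → μ (d ⊕ e)))       ≡⟨ ⟦⟧-cong p (λ d → ⟦⟧-cong q (monomial-⊕ x d)) ⟩
  ⟦ p ⟧ (λ d → ⟦ q ⟧ (λ e → μ d ℤ.* μ e))     ≡⟨ ⟦⟧-cong p (λ d →
                                                    trans (⟦⟧-homo-* q (μ d) μ) (ℤ.*-comm (μ d) _)) ⟩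
  ⟦ p ⟧ (λ d → ⟦ q ⟧ μ ℤ.* μ d)               ≡⟨ ⟦⟧-homo-* p (⟦ q ⟧ μ) μ ⟩
  ⟦ q ⟧ μ ℤ.* ⟦ p ⟧ μ                         ≡⟨ ℤ.*-comm (⟦ q ⟧ μ) _ ⟩
  ⟦ p ⟧ μ ℤ.* ⟦ q ⟧ μ                         ≡⟨ cong₂ ℤ._*_ (eval-⟦⟧ p x) (eval-⟦⟧ q x) ⟨
  eval p x ℤ.* eval q x                       ∎
  where
  open ≡.≡-Reasoning
  μ = monomial x

-- Counting

module _ {a p} {A : Set a} {P : Pred A p} (P? : Decidable P) where

  count : List A → ℕ
  count xs = length (filter P? xs)

  count-++ : ∀ xs ys → count (xs ++ ys) ≡ count xs ℕ.+ count ys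
  count-++ xs ys = trans (cong length (List.filter-++ P? xs ys)) (List.length-++ (filter P? xs))

count-mono : ∀ {a p q} {A : Set a} {P : Pred A p} {Q : Pred A q}
             (P? : Decidable P) (Q? : Decidable Q) {xs} →
             All (λ x → P x → Q x) xs → count P? xs ℕ.≤ count Q? xs
count-mono P? Q? []           = ℕ.z≤n
count-mono P? Q? {x ∷ xs} (P⇒Q ∷ all) with P? x | Q? x
... | yes _  | yes _  = ℕ.s≤s (count-mono P? Q? all)
... | yes px | no ¬qx = contradiction (P⇒Q px) ¬qx
... | no  _  | yes _  = ℕ.m≤n⇒m≤1+n (count-mono P? Q? all)
... | no  _  | no  _  = count-mono P? Q? all

count-map : ∀ {a b p} {A : Set a} {B : Set b} {P : Pred B p} (P? : Decidable P) (f : A → B) xs →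
            count P? (map f xs) ≡ count (λ x → P? (f x)) xs
count-map P? f []       = refl
count-map P? f (x ∷ xs) with P? (f x)
... | yes _ = cong suc (count-map P? f xs)
... | no  _ = count-map P? f xs

module _ {a r p} {A : Set a} {P : Pred (Vec A (suc r)) p} (P? : Decidable P) where

  -- The product list runs through the first coordinate outermost, whereas the induction on
  -- variables fixes the other coordinates; this regroups the count by columns.
  count-column : ∀ S t T →
    count P? (cartesianProductWith _∷_ S (t ∷ T)) ≡
    count (λ x → P? (x ∷ t)) S ℕ.+ count P? (cartesianProductWith _∷_ S T)
  count-column []      t T = refl
  count-column (x ∷ S) t T = begin
    count P? ((x ∷ t) ∷ map (x ∷_) T ++ cartesianProductWith _∷_ S (t ∷ T))
      ≡⟨ count-++ P? ((x ∷ t) ∷ []) (map (x ∷_) T ++ cartesianProductWith _∷_ S (t ∷ T)) ⟩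
    u ℕ.+ count P? (map (x ∷_) T ++ cartesianProductWith _∷_ S (t ∷ T))
      ≡⟨ cong (u ℕ.+_) (count-++ P? (map (x ∷_) T) _) ⟩
    u ℕ.+ (v ℕ.+ count P? (cartesianProductWith _∷_ S (t ∷ T)))
      ≡⟨ cong (λ n → u ℕ.+ (v ℕ.+ n)) (count-column S t T) ⟩
    u ℕ.+ (v ℕ.+ (w ℕ.+ z))
      ≡⟨ rearrange u v w z ⟩
    (u ℕ.+ w) ℕ.+ (v ℕ.+ z)
      ≡⟨ cong₂ ℕ._+_ (trans (cong (ℕ._+ w) (count-map P? (_∷ t) (x ∷ [])))
                            (sym (count-++ (λ x → P? (x ∷ t)) (x ∷ []) S)))
                     (sym (count-++ P? (map (x ∷_) T) _)) ⟩
    count (λ x → P? (x ∷ t)) (x ∷ S) ℕ.+ count P? (map (x ∷_) T ++ cartesianProductWith _∷_ S T)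
      ∎
    where
    open ≡.≡-Reasoning
    u = count P? ((x ∷ t) ∷ [])
    v = count P? (map (x ∷_) T)
    w = count (λ x → P? (x ∷ t)) S
    z = count P? (cartesianProductWith _∷_ S T)
    rearrange : ∀ u v w z → u ℕ.+ (v ℕ.+ (w ℕ.+ z)) ≡ (u ℕ.+ w) ℕ.+ (v ℕ.+ z)
    rearrange = ℕ-Solver.solve-∀

  -- A column over `t` with `Q t` is charged in full; `m` is charged to every column, exceptional or
  -- not.
  count-columns : ∀ {q} {Q : Pred (Vec A r) q} (Q? : Decidable Q) m S T →
    (∀ t → ¬ Q t → count (λ x → P? (x ∷ t)) S ℕ.≤ m) →
    count P? (cartesianProductWith _∷_ S T) ℕ.≤ count Q? T ℕ.* length S ℕ.+ m ℕ.* length T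
  count-columns Q? m S []      col =
    ℕ.≤-trans (ℕ.≤-reflexive (cong (count P?) (List.cartesianProductWith-zeroʳ _∷_ S))) ℕ.z≤n
  count-columns {Q = Q} Q? m S (t ∷ T) col
    rewrite count-column S t T | count-++ Q? (t ∷ []) T = begin
    c ℕ.+ count P? (cartesianProductWith _∷_ S T)
      ≤⟨ ℕ.+-mono-≤ column (count-columns Q? m S T col) ⟩
    (u ℕ.* length S ℕ.+ m) ℕ.+ (count Q? T ℕ.* length S ℕ.+ m ℕ.* length T)
      ≡⟨ rearrange u (length S) m (count Q? T) (length T) ⟩
    (u ℕ.+ count Q? T) ℕ.* length S ℕ.+ m ℕ.* suc (length T)
      ∎
    where
    open ℕ.≤-Reasoning
    c = count (λ x → P? (x ∷ t)) S
    u = count Q? (t ∷ [])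
    column : c ℕ.≤ u ℕ.* length S ℕ.+ m
    column with Q? t
    ... | yes _ = ℕ.≤-trans (List.length-filter _ S)
      (ℕ.≤-trans (ℕ.≤-reflexive (sym (ℕ.*-identityˡ _))) (ℕ.m≤m+n _ m))
    ... | no ¬q = col t ¬q
    rearrange : ∀ u s m c t → (u ℕ.* s ℕ.+ m) ℕ.+ (c ℕ.* s ℕ.+ m ℕ.* t) ≡
                (u ℕ.+ c) ℕ.* s ℕ.+ m ℕ.* (1 ℕ.+ t)
    rearrange = ℕ-Solver.solve-∀

length-cartesianProductWith : ∀ {a b c} {A : Set a} {B : Set b} {C : Set c} (f : A → B → C) xs ys →
  length (cartesianProductWith f xs ys) ≡ length xs ℕ.* length ys
length-cartesianProductWith f []       ys = refl
length-cartesianProductWith f (x ∷ xs) ys =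
  trans (List.length-++ (map (f x) ys))
        (cong₂ ℕ._+_ (List.length-map (f x) ys) (length-cartesianProductWith f xs ys))

-- Roots in one variable

-- The leading coefficient comes first, then the others from the constant term up.

horner : ∀ {n} → ℤ → Vec ℤ n → ℤ → ℤ
horner c []       x = c
horner c (b ∷ cs) x = b ℤ.+ x ℤ.* horner c cs x

-- Synthetic division by x - s: the intermediate Horner values at `s` are the coefficients of the
-- quotient. The leading coefficient `c` is unchanged and so remains nonzero.
quotientAt : ∀ {n} → ℤ → ℤ → Vec ℤ n → Vec ℤ n
quotientAt s c []       = []
quotientAt s c (b ∷ cs) = horner c (b ∷ cs) s ∷ quotientAt s c cs

horner-factor : ∀ {n} s c b (cs : Vec ℤ n) x →
  horner c (b ∷ cs) x ≡ horner c (b ∷ cs) s ℤ.+ (x ℤ.- s) ℤ.* horner c (quotientAt s c cs) x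
horner-factor s c b []        x = base b c s x
  where
  base : ∀ b c s x → b ℤ.+ x ℤ.* c ≡ (b ℤ.+ s ℤ.* c) ℤ.+ (x ℤ.- s) ℤ.* c
  base = solve-∀
horner-factor s c b (b′ ∷ cs) x =
  trans (cong (λ y → b ℤ.+ x ℤ.* y) (horner-factor s c b′ cs x))
        (step b s x (horner c (b′ ∷ cs) s) (horner c (quotientAt s c cs) x))
  where
  step : ∀ b s x h q → b ℤ.+ x ℤ.* (h ℤ.+ (x ℤ.- s) ℤ.* q) ≡
                       (b ℤ.+ s ℤ.* h) ℤ.+ (x ℤ.- s) ℤ.* (h ℤ.+ x ℤ.* q)
  step = solve-∀

root? : ∀ {n} c (cs : Vec ℤ n) → Decidable (λ x → horner c cs x ≡ 0ℤ)
root? c cs x = horner c cs x ℤ.≟ 0ℤ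

-- Once a root `s` is divided out, the remaining elements of `S` differ from `s`, so any roots among
-- them are roots of the quotient, which has one coefficient fewer.
count-roots : ∀ {n} c (cs : Vec ℤ n) → c ≢ 0ℤ → ∀ {S} → Unique S → count (root? c cs) S ℕ.≤ n
count-roots c []       c≢0 {S} uniq =
  ℕ.≤-reflexive (cong length (List.filter-none (root? c []) (All.universal (λ _ → c≢0) S)))
count-roots c (b ∷ cs) c≢0 []   = ℕ.z≤n
count-roots {suc n} c (b ∷ cs) c≢0 {s ∷ S} (s∉S ∷ uniq) with root? c (b ∷ cs) s
... | no  _     = count-roots c (b ∷ cs) c≢0 uniq
... | yes fs≡0 = ℕ.s≤s (ℕ.≤-trans
  (count-mono (root? c (b ∷ cs)) (root? c (quotientAt s c cs)) (All.map other-root s∉S))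
  (count-roots c (quotientAt s c cs) c≢0 uniq))
  where
  other-root : ∀ {x} → s ≢ x → horner c (b ∷ cs) x ≡ 0ℤ → horner c (quotientAt s c cs) x ≡ 0ℤ
  other-root {x} s≢x fx≡0 =
    [ (λ x-s≡0 → contradiction (sym (ℤ.i-j≡0⇒i≡j x s x-s≡0)) s≢x) , (λ q≡0 → q≡0) ]′
      (ℤ.i*j≡0⇒i≡0∨j≡0 (x ℤ.- s) (trans (sym (trans (horner-factor s c b cs x)
        (trans (cong (ℤ._+ _) fs≡0) (ℤ.+-identityˡ _)))) fx≡0))

-- The Schwartz–Zippel bound

vanishes? : ∀ {r} (p : Poly r) → Decidable (λ x → eval p x ≡ 0ℤ)
vanishes? p x = eval p x ℤ.≟ 0ℤ

-- A polynomial in r + 1 variables as the list of its coefficients of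
-- x₁^k, x₁^(k+1), … in the other variables.

⟦_⟧ˢ : ∀ {r} → List (Poly r) → ℕ → (Vec ℕ (suc r) → ℤ) → ℤ
⟦ []     ⟧ˢ k φ = 0ℤ
⟦ p ∷ ps ⟧ˢ k φ = ⟦ p ⟧ (φ ∘ (k ∷_)) ℤ.+ ⟦ ps ⟧ˢ (suc k) φ

-- The bound is on the terms as listed, not on `deg`: it is inherited by each slice without any
-- normalisation.
data Bounded {r} (d : ℕ) : ℕ → List (Poly r) → Set where
  []  : ∀ {k} → Bounded d k []
  _∷_ : ∀ {k p ps} → All (λ t → k ℕ.+ Vec.sum (proj₂ t) ℕ.≤ d) p →
        Bounded d (suc k) ps → Bounded d k (p ∷ ps)

addTerm : ∀ {r} → ℤ × Vec ℕ r → ℕ → List (Poly r) → List (Poly r)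
addTerm t zero    []       = (t ∷ []) ∷ []
addTerm t zero    (p ∷ ps) = (t ∷ p) ∷ ps
addTerm t (suc j) []       = [] ∷ addTerm t j []
addTerm t (suc j) (p ∷ ps) = p ∷ addTerm t j ps

slices : ∀ {r} → Poly (suc r) → List (Poly r)
slices []                = []
slices ((a , j ∷ e) ∷ p) = addTerm (a , e) j (slices p)

⟦addTerm⟧ : ∀ {r} a (e : Vec ℕ r) j ps k φ →
  ⟦ addTerm (a , e) j ps ⟧ˢ k φ ≡ a ℤ.* φ (j ℕ.+ k ∷ e) ℤ.+ ⟦ ps ⟧ˢ k φ
⟦addTerm⟧ a e zero    []       k φ = ℤ.+-identityʳ _
⟦addTerm⟧ a e zero    (p ∷ ps) k φ = ℤ.+-assoc (a ℤ.* φ (k ∷ e)) _ _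
⟦addTerm⟧ a e (suc j) []       k φ rewrite ⟦addTerm⟧ a e j [] (suc k) φ | ℕ.+-suc j k =
  ℤ.+-identityˡ _
⟦addTerm⟧ a e (suc j) (p ∷ ps) k φ rewrite ⟦addTerm⟧ a e j ps (suc k) φ | ℕ.+-suc j k =
  swap (⟦ p ⟧ (φ ∘ (k ∷_))) (a ℤ.* φ (suc (j ℕ.+ k) ∷ e)) (⟦ ps ⟧ˢ (suc k) φ)
  where
  swap : ∀ x y z → x ℤ.+ (y ℤ.+ z) ≡ y ℤ.+ (x ℤ.+ z)
  swap = solve-∀

⟦slices⟧ : ∀ {r} (p : Poly (suc r)) φ → ⟦ slices p ⟧ˢ 0 φ ≡ ⟦ p ⟧ φ
⟦slices⟧ []                φ = refl
⟦slices⟧ ((a , j ∷ e) ∷ p) φ = trans (⟦addTerm⟧ a e j (slices p) 0 φ)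
  (cong₂ (λ i x → a ℤ.* φ (i ∷ e) ℤ.+ x) (ℕ.+-identityʳ j) (⟦slices⟧ p φ))

addTerm-bounded : ∀ {r d} a (e : Vec ℕ r) j {ps k} → j ℕ.+ k ℕ.+ Vec.sum e ℕ.≤ d →
                  Bounded d k ps → Bounded d k (addTerm (a , e) j ps)
addTerm-bounded a e zero    je≤d []       = (je≤d ∷ []) ∷ []
addTerm-bounded a e zero    je≤d (b ∷ bs) = (je≤d ∷ b) ∷ bs
addTerm-bounded {d = d} a e (suc j) {ps} {k} je≤d bs = cons bs
  where
  je≤d′ : j ℕ.+ suc k ℕ.+ Vec.sum e ℕ.≤ d
  je≤d′ = subst (λ i → i ℕ.+ Vec.sum e ℕ.≤ d) (sym (ℕ.+-suc j k)) je≤d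
  cons : ∀ {ps} → Bounded d k ps → Bounded d k (addTerm (a , e) (suc j) ps)
  cons []       = [] ∷ addTerm-bounded a e j je≤d′ []
  cons (b ∷ bs) = b ∷ addTerm-bounded a e j je≤d′ bs

slices-bounded : ∀ {r d} (p : Poly (suc r)) → All (λ t → Vec.sum (proj₂ t) ℕ.≤ d) p →
                 Bounded d 0 (slices p)
slices-bounded []                []       = []
slices-bounded {d = d} ((a , j ∷ e) ∷ p) (b ∷ bs) = addTerm-bounded a e j
  (subst (λ i → i ℕ.+ Vec.sum e ℕ.≤ d) (sym (ℕ.+-identityʳ j)) b) (slices-bounded p bs)

-- The highest slice that is not identically zero, with those below it arranged in Horner form.
-- Slices above it vanish under every functional and are dropped from `value`.
record Top {r} (d k : ℕ) (ps : List (Poly r)) : Set where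
  field
    height  : ℕ
    lower   : Vec (Poly r) height
    top     : Poly r
    leading : Leading 0ℤ top
    bounded : All (λ t → height ℕ.+ k ℕ.+ Vec.sum (proj₂ t) ℕ.≤ d) top
    value   : ∀ x xs → ⟦ ps ⟧ˢ k (monomial (x ∷ xs)) ≡
              x ^ k ℤ.* horner (eval top xs) (Vec.map (λ q → eval q xs) lower) x

slice-eval : ∀ {r} (p : Poly r) k x xs →
  ⟦ p ⟧ (monomial (x ∷ xs) ∘ (k ∷_)) ≡ x ^ k ℤ.* eval p xs
slice-eval p k x xs =
  trans (⟦⟧-homo-* p (x ^ k) (monomial xs)) (cong (x ^ k ℤ.*_) (sym (eval-⟦⟧ p xs)))

top? : ∀ {r d k} (ps : List (Poly r)) → Bounded d k ps →
       (∀ φ → ⟦ ps ⟧ˢ k φ ≡ 0ℤ) ⊎ Top d k ps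
top?         []       []       = inj₁ (λ _ → refl)
top? {d = d} {k} (p ∷ ps) (b ∷ bs) with top? ps bs
... | inj₂ t = inj₂ record
  { height = suc height ; lower = p ∷ lower ; top = top ; leading = leading
  ; bounded = All.map (λ {t} →
      subst (λ i → i ℕ.+ Vec.sum (proj₂ t) ℕ.≤ d) (ℕ.+-suc height k)) bounded
  ; value = λ x xs → trans (cong₂ ℤ._+_ (slice-eval p k x xs) (value x xs))
                           (collect x (x ^ k) (eval p xs) _) }
  where
  open Top t
  collect : ∀ x y u h → y ℤ.* u ℤ.+ x ℤ.* y ℤ.* h ≡ y ℤ.* (u ℤ.+ x ℤ.* h)
  collect = solve-∀
... | inj₁ ps≡0 with leading? 0ℤ p
...   | inj₁ (q , p≡0) = inj₁ (λ φ → cong₂ ℤ._+_ (p≡0 (φ ∘ (k ∷_))) (ps≡0 φ))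
...   | inj₂ l = inj₂ record
  { height = 0 ; lower = [] ; top = p ; leading = l ; bounded = b
  ; value = λ x xs → trans (cong₂ ℤ._+_ (slice-eval p k x xs) (ps≡0 _)) (ℤ.+-identityʳ _) }

≋0⇒¬leading : ∀ {r} {p : Poly r} → (∀ φ → ⟦ p ⟧ φ ≡ 0ℤ) → ¬ Leading 0ℤ p
≋0⇒¬leading {p = p} p≡0 l =
  leading-coeff l (divides 0ℤ (trans (coeff-⟦⟧ p (Leading.exponent l)) (p≡0 _)))

-- The bound d #S^(r-1) is multiplied through by `length S`, which avoids the exponent r - 1 and
-- admits `r = 0`, where a nonzero constant has no zeros. In the induction, the coefficient `top` of
-- the highest power m of the first variable has degree at most d - m. Where it vanishes a full
-- column is charged; every other column has at most m zeros.
schwartz-zippel : ∀ {r} (p : Poly r) d → Leading 0ℤ p →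
  All (λ t → Vec.sum (proj₂ t) ℕ.≤ d) p → ∀ {S} → Unique S →
  count (vanishes? p) (power S r) ℕ.* length S ℕ.≤ d ℕ.* length (power S r)
schwartz-zippel {zero} p d l b {S} uniq with vanishes? p []
... | no  _   = ℕ.z≤n
... | yes p≡0 = contradiction l (≋0⇒¬leading (λ φ →
  trans (constant φ) (cong (ℤ._* φ []) (trans (sym (eval-⟦⟧ p [])) p≡0))))
  where
  -- Without variables `[]` is the only exponent, so every functional is a multiple of evaluation.
  constant : ∀ φ → ⟦ p ⟧ φ ≡ ⟦ p ⟧ (monomial []) ℤ.* φ []
  constant φ = trans
    (⟦⟧-cong p {φ} {λ e → φ [] ℤ.* monomial [] e} (λ { [] → sym (ℤ.*-identityʳ (φ [])) }))
    (trans (⟦⟧-homo-* p (φ []) (monomial [])) (ℤ.*-comm (φ []) _))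
schwartz-zippel {suc r} p d l b {S} uniq with top? (slices p) (slices-bounded p b)
... | inj₁ p≡0 = contradiction l (≋0⇒¬leading (λ φ → trans (sym (⟦slices⟧ p φ)) (p≡0 φ)))
... | inj₂ t   = begin
  count (vanishes? p) (power S (suc r)) ℕ.* n
    ≤⟨ ℕ.*-monoˡ-≤ n (count-columns (vanishes? p) (vanishes? top) m S (power S r) column) ⟩
  (c ℕ.* n ℕ.+ m ℕ.* N) ℕ.* n
    ≤⟨ ℕ.*-monoˡ-≤ n (ℕ.+-monoˡ-≤ (m ℕ.* N)
         (schwartz-zippel top (d ℕ.∸ m) leading top-bounded uniq)) ⟩
  ((d ℕ.∸ m) ℕ.* N ℕ.+ m ℕ.* N) ℕ.* n
    ≡⟨ rearrange (d ℕ.∸ m) m N n ⟩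
  (d ℕ.∸ m ℕ.+ m) ℕ.* (n ℕ.* N)
    ≡⟨ cong₂ ℕ._*_ (ℕ.m∸n+n≡m m≤d) (sym (length-cartesianProductWith _∷_ S (power S r))) ⟩
  d ℕ.* length (power S (suc r)) ∎
  where
  open ℕ.≤-Reasoning
  open Top t renaming (height to m)
  n = length S
  N = length (power S r)
  c = count (vanishes? top) (power S r)

  rearrange : ∀ a m N n → (a ℕ.* N ℕ.+ m ℕ.* N) ℕ.* n ≡ (a ℕ.+ m) ℕ.* (n ℕ.* N)
  rearrange = ℕ-Solver.solve-∀

  bounded′ : All (λ t → m ℕ.+ Vec.sum (proj₂ t) ℕ.≤ d) top
  bounded′ = All.map (λ {t} → subst (λ i → i ℕ.+ Vec.sum (proj₂ t) ℕ.≤ d) (ℕ.+-identityʳ m)) bounded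

  top-bounded : All (λ t → Vec.sum (proj₂ t) ℕ.≤ d ℕ.∸ m) top
  top-bounded = All.map (λ {t} b → ℕ.m+n≤o⇒m≤o∸n (Vec.sum (proj₂ t))
    (subst (ℕ._≤ d) (ℕ.+-comm m _) b)) bounded′

  -- An actual term of `top` is needed to witness m ≤ d; only then is the truncated difference
  -- `d ℕ.∸ m` exact.
  nonempty : ∀ {q : Poly r} → Leading 0ℤ q → All (λ t → m ℕ.+ Vec.sum (proj₂ t) ℕ.≤ d) q → m ℕ.≤ d
  nonempty {[]}    l []      = contradiction l (≋0⇒¬leading (λ _ → refl))
  nonempty {_ ∷ _} l (b ∷ _) = ℕ.m+n≤o⇒m≤o m b

  m≤d : m ℕ.≤ d
  m≤d = nonempty leading bounded′

  column : ∀ xs → ¬ eval top xs ≡ 0ℤ → count (λ x → vanishes? p (x ∷ xs)) S ℕ.≤ m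
  column xs top≢0 = ℕ.≤-trans
    (count-mono _ (root? (eval top xs) (Vec.map (λ q → eval q xs) lower))
      (All.universal (λ x px≡0 → trans (sym (ℤ.*-identityˡ _)) (trans (sym (value x xs))
        (trans (⟦slices⟧ p _) (trans (sym (eval-⟦⟧ p (x ∷ xs))) px≡0)))) S))
    (count-roots (eval top xs) (Vec.map (λ q → eval q xs) lower) top≢0 uniq)

-- Clearing denominators

ι : ℤ → ℚ
ι a = a ℚ./ 1

fromℚᵘ-homo-+ : ∀ p q → ℚ.fromℚᵘ (p ℚᵘ.+ q) ≡ ℚ.fromℚᵘ p ℚ.+ ℚ.fromℚᵘ q
fromℚᵘ-homo-+ p q = ℚ.toℚᵘ-injective (ℚᵘ.≃-trans (ℚ.toℚᵘ-fromℚᵘ (p ℚᵘ.+ q)) (ℚᵘ.≃-sym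
  (ℚᵘ.≃-trans (ℚ.toℚᵘ-homo-+ (ℚ.fromℚᵘ p) (ℚ.fromℚᵘ q))
              (ℚᵘ.+-cong (ℚ.toℚᵘ-fromℚᵘ p) (ℚ.toℚᵘ-fromℚᵘ q)))))

fromℚᵘ-homo-* : ∀ p q → ℚ.fromℚᵘ (p ℚᵘ.* q) ≡ ℚ.fromℚᵘ p ℚ.* ℚ.fromℚᵘ q
fromℚᵘ-homo-* p q = ℚ.toℚᵘ-injective (ℚᵘ.≃-trans (ℚ.toℚᵘ-fromℚᵘ (p ℚᵘ.* q)) (ℚᵘ.≃-sym
  (ℚᵘ.≃-trans (ℚ.toℚᵘ-homo-* (ℚ.fromℚᵘ p) (ℚ.fromℚᵘ q))
              (ℚᵘ.*-cong (ℚ.toℚᵘ-fromℚᵘ p) (ℚ.toℚᵘ-fromℚᵘ q)))))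

ι-homo-+ : ∀ a b → ι (a ℤ.+ b) ≡ ι a ℚ.+ ι b
ι-homo-+ a b = trans
  (cong₂ (λ x y → ι (x ℤ.+ y)) (sym (ℤ.*-identityʳ a)) (sym (ℤ.*-identityʳ b)))
  (fromℚᵘ-homo-+ (mkℚᵘ a 0) (mkℚᵘ b 0))

ι-homo-* : ∀ a b → ι (a ℤ.* b) ≡ ι a ℚ.* ι b
ι-homo-* a b = fromℚᵘ-homo-* (mkℚᵘ a 0) (mkℚᵘ b 0)

ι-injective : ∀ {a b} → ι a ≡ ι b → a ≡ b
ι-injective {a} {b} eq with *≡* a*1≡b*1 ← ℚ.fromℚᵘ-injective {mkℚᵘ a 0} {mkℚᵘ b 0} eq =
  trans (sym (ℤ.*-identityʳ a)) (trans a*1≡b*1 (ℤ.*-identityʳ b))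

↧*p≡↥ : ∀ p → ι (ℚ.↧ p) ℚ.* p ≡ ι (ℚ.↥ p)
↧*p≡↥ p@(mkℚ n d-1 _) = trans (cong (ι (ℚ.↧ p) ℚ.*_) (sym (ℚ.fromℚᵘ-toℚᵘ p)))
  (trans (sym (fromℚᵘ-homo-* (mkℚᵘ (ℚ.↧ p) 0) (mkℚᵘ n d-1)))
         (ℚ.fromℚᵘ-cong {mkℚᵘ (ℚ.↧ p) 0 ℚᵘ.* mkℚᵘ n d-1} {mkℚᵘ n 0}
           (*≡* (trans (ℤ.*-identityʳ (ℚ.↧ p ℤ.* n)) (trans (ℤ.*-comm (ℚ.↧ p) n)
             (cong (λ m → n ℤ.* + m) (sym (ℕ.*-identityˡ (suc d-1)))))))))

ι*≡0⇒≡0 : ∀ m → ℕ.NonZero m → ∀ p → ι (+ m) ℚ.* p ≡ 0ℚ → p ≡ 0ℚ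
ι*≡0⇒≡0 m m≢0 p mp≡0 = ℚ.↥p≡0⇒p≡0 p (ℤ.*-cancelˡ-≡ (+ m) (ℚ.↥ p) 0ℤ {{m≢0}}
  (trans (ι-injective (begin
    ι (+ m ℤ.* ℚ.↥ p)               ≡⟨ ι-homo-* (+ m) (ℚ.↥ p) ⟩
    ι (+ m) ℚ.* ι (ℚ.↥ p)           ≡⟨ cong (ι (+ m) ℚ.*_) (↧*p≡↥ p) ⟨
    ι (+ m) ℚ.* (ι (ℚ.↧ p) ℚ.* p)   ≡⟨ p*qr≡q*pr (ι (+ m)) (ι (ℚ.↧ p)) p ⟩
    ι (ℚ.↧ p) ℚ.* (ι (+ m) ℚ.* p)   ≡⟨ cong (ι (ℚ.↧ p) ℚ.*_) mp≡0 ⟩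
    ι (ℚ.↧ p) ℚ.* 0ℚ                ≡⟨ ℚ.*-zeroʳ (ι (ℚ.↧ p)) ⟩
    ι 0ℤ                            ∎))
    (sym (ℤ.*-zeroʳ (+ m)))))
  where
  open ≡.≡-Reasoning

⟦toℚ[X]⟧ : ∀ {r} (p : Poly r) φ → ℚF.⟦ toℚ[X] p ⟧ (ι ∘ φ) ≡ ι (⟦ p ⟧ φ)
⟦toℚ[X]⟧ []            φ = refl
⟦toℚ[X]⟧ ((a , e) ∷ p) φ = sym (trans (ι-homo-+ (a ℤ.* φ e) (⟦ p ⟧ φ))
  (cong₂ ℚ._+_ (ι-homo-* a (φ e)) (sym (⟦toℚ[X]⟧ p φ))))

ι-δ : ∀ {r} (d e : Vec ℕ r) → ℚF.δ d e ≡ ι (δ d e)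
ι-δ d e with Vec.≡-dec ℕ._≟_ e d
... | yes _ = refl
... | no  _ = refl

⟦toℚ[X]⟧-scale : ∀ {r} c (p : Poly r) φ →
  ℚF.⟦ toℚ[X] (scale c p) ⟧ φ ≡ ι c ℚ.* ℚF.⟦ toℚ[X] p ⟧ φ
⟦toℚ[X]⟧-scale c []            φ = sym (ℚ.*-zeroʳ (ι c))
⟦toℚ[X]⟧-scale c ((a , e) ∷ p) φ = trans
  (cong₂ ℚ._+_ (trans (cong (ℚ._* φ e) (ι-homo-* c a)) (ℚ.*-assoc (ι c) (ι a) (φ e)))
               (⟦toℚ[X]⟧-scale c p φ))
  (sym (ℚ.*-distribˡ-+ (ι c) _ _))

-- All functionals are required, not only point masses, because `product-IsMultiple` applies the
-- equality to the functional induced by the other factor.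
record IsMultiple {r} (m : ℕ) (q : ℚ[X].Poly r) (p : Poly r) : Set where
  constructor isMultiple
  field
    equality : ∀ φ → ℚF.⟦ toℚ[X] p ⟧ φ ≡ ι (+ m) ℚ.* ℚF.⟦ q ⟧ φ

open IsMultiple

scale-IsMultiple : ∀ {r} n {m} {q : ℚ[X].Poly r} {p} →
                   IsMultiple m q p → IsMultiple (n ℕ.* m) q (scale (+ n) p)
scale-IsMultiple n {m} {q} {p} mul = isMultiple λ φ → begin
  ℚF.⟦ toℚ[X] (scale (+ n) p) ⟧ φ       ≡⟨ ⟦toℚ[X]⟧-scale (+ n) p φ ⟩
  ι (+ n) ℚ.* ℚF.⟦ toℚ[X] p ⟧ φ         ≡⟨ cong (ι (+ n) ℚ.*_) (equality mul φ) ⟩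
  ι (+ n) ℚ.* (ι (+ m) ℚ.* ℚF.⟦ q ⟧ φ)  ≡⟨ ℚ.*-assoc (ι (+ n)) (ι (+ m)) _ ⟨
  ι (+ n) ℚ.* ι (+ m) ℚ.* ℚF.⟦ q ⟧ φ    ≡⟨ cong (ℚ._* ℚF.⟦ q ⟧ φ) (ι-homo-* (+ n) (+ m)) ⟨
  ι (+ n ℤ.* + m) ℚ.* ℚF.⟦ q ⟧ φ        ≡⟨ cong (λ x → ι x ℚ.* ℚF.⟦ q ⟧ φ) (ℤ.pos-* n m) ⟨
  ι (+ (n ℕ.* m)) ℚ.* ℚF.⟦ q ⟧ φ        ∎
  where open ≡.≡-Reasoning

clear-denominators : ∀ {r} (q : ℚ[X].Poly r) →
                     Σ[ m ∈ ℕ ] ℕ.NonZero m × Σ[ p ∈ Poly r ] IsMultiple m q p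
clear-denominators []            = 1 , _ , [] , isMultiple λ _ → refl
clear-denominators ((a , e) ∷ q) with clear-denominators q
... | m , m≢0 , p , mul =
  d ℕ.* m , ℕ.m*n≢0 d m {{_}} {{m≢0}} ,
  (ℚ.↥ a ℤ.* + m , e) ∷ scale (+ d) p , isMultiple λ φ → begin
  ι (ℚ.↥ a ℤ.* + m) ℚ.* φ e ℚ.+ ℚF.⟦ toℚ[X] (scale (+ d) p) ⟧ φ
    ≡⟨ cong₂ (λ x y → x ℚ.* φ e ℚ.+ y)
         (trans (ι-homo-* (ℚ.↥ a) (+ m)) (cong (ℚ._* ι (+ m)) (sym (↧*p≡↥ a))))
         (equality (scale-IsMultiple d mul) φ) ⟩
  ι (+ d) ℚ.* a ℚ.* ι (+ m) ℚ.* φ e ℚ.+ ι (+ (d ℕ.* m)) ℚ.* ℚF.⟦ q ⟧ φ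
    ≡⟨ cong (λ x → ι (+ d) ℚ.* a ℚ.* ι (+ m) ℚ.* φ e ℚ.+ x ℚ.* ℚF.⟦ q ⟧ φ) dm ⟩
  ι (+ d) ℚ.* a ℚ.* ι (+ m) ℚ.* φ e ℚ.+ ι (+ d) ℚ.* ι (+ m) ℚ.* ℚF.⟦ q ⟧ φ
    ≡⟨ collect (ι (+ d)) a (ι (+ m)) (φ e) _ ⟩
  ι (+ d) ℚ.* ι (+ m) ℚ.* (a ℚ.* φ e ℚ.+ ℚF.⟦ q ⟧ φ)
    ≡⟨ cong (ℚ._* _) dm ⟨
  ι (+ (d ℕ.* m)) ℚ.* (a ℚ.* φ e ℚ.+ ℚF.⟦ q ⟧ φ)
    ∎
  where
  open ≡.≡-Reasoning
  d = ℚ.↧ₙ a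
  dm : ι (+ (d ℕ.* m)) ≡ ι (+ d) ℚ.* ι (+ m)
  dm = trans (cong ι (ℤ.pos-* d m)) (ι-homo-* (+ d) (+ m))
  collect : ∀ d a m x y → d ℚ.* a ℚ.* m ℚ.* x ℚ.+ d ℚ.* m ℚ.* y ≡ d ℚ.* m ℚ.* (a ℚ.* x ℚ.+ y)
  collect = solve 5 (λ d a m x y →
    d :* a :* m :* x :+ d :* m :* y := d :* m :* (a :* x :+ y)) refl
    where open ℚ.+-*-Solver

-- One multiplier for all quotients lets `gauss` cancel the same list of primes for every index.
clear-common-denominator : ∀ {r s} (Q : Fin s → ℚ[X].Poly r) →
  Σ[ m ∈ ℕ ] ℕ.NonZero m × Σ[ P ∈ (Fin s → Poly r) ] (∀ i → IsMultiple m (Q i) (P i))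
clear-common-denominator {s = zero}  Q = 1 , _ , (λ ()) , λ ()
clear-common-denominator {s = suc s} Q
  with m , m≢0 , p , mul ← clear-denominators (Q zero)
     | n , n≢0 , P , muls ← clear-common-denominator (Q ∘ suc) =
  m ℕ.* n , ℕ.m*n≢0 m n {{m≢0}} {{n≢0}} ,
  (λ { zero → scale (+ n) p ; (suc i) → scale (+ m) (P i) }) ,
  λ { zero    → subst (λ k → IsMultiple k (Q zero) (scale (+ n) p)) (ℕ.*-comm n m)
                      (scale-IsMultiple n mul)
    ; (suc i) → scale-IsMultiple m (muls i) }

-- From a rational to an integral common divisor

product-IsMultiple : ∀ {r m n} {p₁ p₂ p : Poly r} {q₁ q₂ : ℚ[X].Poly r} →
  IsMultiple m q₁ p₁ → IsMultiple n q₂ p₂ → q₁ ℚ[X].*ₚ q₂ ℚ[X].≈ₚ toℚ[X] p →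
  p₁ *ₚ p₂ ≈ₚ scale (+ (m ℕ.* n)) p
product-IsMultiple {m = m} {n} {p₁} {p₂} {p} {q₁} {q₂} mul₁ mul₂ q≈p e = ι-injective (begin
  ι (coeff (p₁ *ₚ p₂) e)
    ≡⟨ cong ι (trans (coeff-⟦⟧ (p₁ *ₚ p₂) e) (⟦*ₚ⟧ p₁ p₂ (δ e))) ⟩
  ι (⟦ p₁ ⟧ (λ x → ⟦ p₂ ⟧ (λ y → δ e (x ⊕ y))))
    ≡⟨ ⟦toℚ[X]⟧ p₁ _ ⟨
  ℚF.⟦ toℚ[X] p₁ ⟧ (λ x → ι (⟦ p₂ ⟧ (λ y → δ e (x ⊕ y))))
    ≡⟨ equality mul₁ _ ⟩
  ι (+ m) ℚ.* ℚF.⟦ q₁ ⟧ (λ x → ι (⟦ p₂ ⟧ (λ y → δ e (x ⊕ y))))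
    ≡⟨ cong (ι (+ m) ℚ.*_) (ℚF.⟦⟧-cong q₁ (λ x → trans (sym (⟦toℚ[X]⟧ p₂ _))
         (trans (ℚF.⟦⟧-cong (toℚ[X] p₂) (λ y → sym (ι-δ e (x ⊕ y)))) (equality mul₂ _)))) ⟩
  ι (+ m) ℚ.* ℚF.⟦ q₁ ⟧ (λ x → ι (+ n) ℚ.* ℚF.⟦ q₂ ⟧ (λ y → ℚF.δ e (x ⊕ y)))
    ≡⟨ cong (ι (+ m) ℚ.*_) (ℚF.⟦⟧-homo-* q₁ (ι (+ n)) _) ⟩
  ι (+ m) ℚ.* (ι (+ n) ℚ.* ℚF.⟦ q₁ ⟧ (λ x → ℚF.⟦ q₂ ⟧ (λ y → ℚF.δ e (x ⊕ y))))
    ≡⟨ ℚ.*-assoc (ι (+ m)) (ι (+ n)) _ ⟨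
  ι (+ m) ℚ.* ι (+ n) ℚ.* ℚF.⟦ q₁ ⟧ (λ x → ℚF.⟦ q₂ ⟧ (λ y → ℚF.δ e (x ⊕ y)))
    ≡⟨ cong₂ ℚ._*_ mn (sym (ℚF.⟦*ₚ⟧ q₁ q₂ (ℚF.δ e))) ⟩
  ι (+ (m ℕ.* n)) ℚ.* ℚF.⟦ q₁ ℚ[X].*ₚ q₂ ⟧ (ℚF.δ e)
    ≡⟨ cong (ι (+ (m ℕ.* n)) ℚ.*_) (trans (sym (ℚF.coeff-⟦⟧ (q₁ ℚ[X].*ₚ q₂) e))
         (trans (q≈p e) (trans (ℚF.coeff-⟦⟧ (toℚ[X] p) e)
           (trans (ℚF.⟦⟧-cong (toℚ[X] p) (ι-δ e)) (⟦toℚ[X]⟧ p (δ e)))))) ⟩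
  ι (+ (m ℕ.* n)) ℚ.* ι (⟦ p ⟧ (δ e))
    ≡⟨ ι-homo-* (+ (m ℕ.* n)) (⟦ p ⟧ (δ e)) ⟨
  ι (+ (m ℕ.* n) ℤ.* ⟦ p ⟧ (δ e))
    ≡⟨ cong ι (trans (coeff-⟦⟧ (scale (+ (m ℕ.* n)) p) e) (⟦scale⟧ (+ (m ℕ.* n)) p (δ e))) ⟨
  ι (coeff (scale (+ (m ℕ.* n)) p) e)
    ∎)
  where
  open ≡.≡-Reasoning
  mn : ι (+ m) ℚ.* ι (+ n) ≡ ι (+ (m ℕ.* n))
  mn = sym (trans (cong ι (ℤ.pos-* m n)) (ι-homo-* (+ m) (+ n)))

rational-multiples : ∀ {r s} (P : Fin s → Poly r) (D : ℚ[X].Poly r) →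
  (∀ i → D ℚ[X].∣ toℚ[X] (P i)) →
  Σ[ n ∈ ℕ ] Σ[ m ∈ ℕ ] ℕ.NonZero n × ℕ.NonZero m ×
  Σ[ Q ∈ (Fin s → Poly r) ] Σ[ D′ ∈ Poly r ]
    (∀ i → Q i *ₚ D′ ≈ₚ scale (+ (n ℕ.* m)) (P i)) × IsMultiple m D D′
rational-multiples P D D∣P =
  let m , m≢0 , D′ , mulD = clear-denominators D
      n , n≢0 , Q , mulQ = clear-common-denominator (λ i → _∣ʳ_.quotient (D∣P i))
  in n , m , n≢0 , m≢0 , Q , D′ ,
     (λ i → product-IsMultiple {p = P i} (mulQ i) mulD (_∣ʳ_.equality (D∣P i))) , mulD

IsMultiple⇒coeff≢0 : ∀ {r m} {q : ℚ[X].Poly r} {p e} → ℕ.NonZero m → IsMultiple m q p →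
                     ℚ[X].coeff q e ≢ 0ℚ → coeff p e ≢ 0ℤ
IsMultiple⇒coeff≢0 {m = m} {q} {p} {e} m≢0 mul q≢0 p≡0 = q≢0 (ι*≡0⇒≡0 m m≢0 _ (begin
  ι (+ m) ℚ.* ℚ[X].coeff q e      ≡⟨ cong (ι (+ m) ℚ.*_) (ℚF.coeff-⟦⟧ q e) ⟩
  ι (+ m) ℚ.* ℚF.⟦ q ⟧ (ℚF.δ e)   ≡⟨ equality mul (ℚF.δ e) ⟨
  ℚF.⟦ toℚ[X] p ⟧ (ℚF.δ e)        ≡⟨ ℚF.⟦⟧-cong (toℚ[X] p) (ι-δ e) ⟩
  ℚF.⟦ toℚ[X] p ⟧ (ι ∘ δ e)       ≡⟨ ⟦toℚ[X]⟧ p (δ e) ⟩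
  ι (⟦ p ⟧ (δ e))                 ≡⟨ cong ι (trans (sym (coeff-⟦⟧ p e)) p≡0) ⟩
  0ℚ                              ∎))
  where open ≡.≡-Reasoning

-- Positive degree is carried along as a nonzero coefficient at an exponent of positive sum. This
-- survives clearing denominators as well as the removal of a constant factor, so no degree has to
-- be recomputed.
integral-divisor : ∀ {r s} (P : Fin s → Poly r) (D : ℚ[X].Poly r) →
  0 ℕ.< ℚ[X].deg D → (∀ i → D ℚ[X].∣ toℚ[X] (P i)) →
  Σ[ D′ ∈ Poly r ] Σ[ Q ∈ (Fin s → Poly r) ] (∀ i → Q i *ₚ D′ ≋ P i) ×
    (∃[ e ] 0 ℕ.< Vec.sum e × coeff D′ e ≢ 0ℤ)
integral-divisor {r} {s} P D 0<deg D∣P =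
  let n , m , n≢0 , m≢0 , Q₁ , D₁ , Q₁D₁≈ , mul = rational-multiples P D D∣P
  in descend (n ℕ.* m) (factorise (n ℕ.* m) {{ℕ.m*n≢0 n m {{n≢0}} {{m≢0}}}}) Q₁ D₁ Q₁D₁≈
       (let e , 0<e , De≢0 = ℚF.0<deg⇒coeff≉0 D 0<deg
        in e , 0<e , IsMultiple⇒coeff≢0 {q = D} m≢0 mul De≢0)
  where
  descend : ∀ n → PrimeFactorisation n → ∀ Q₁ D₁ → (∀ i → Q₁ i *ₚ D₁ ≈ₚ scale (+ n) (P i)) →
    (∃[ e ] 0 ℕ.< Vec.sum e × coeff D₁ e ≢ 0ℤ) →
    Σ[ D′ ∈ Poly r ] Σ[ Q ∈ (Fin s → Poly r) ] (∀ i → Q i *ₚ D′ ≋ P i) ×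
      (∃[ e ] 0 ℕ.< Vec.sum e × coeff D′ e ≢ 0ℤ)
  descend n record { factors = ps ; isFactorisation = n≡ ; factorsPrime = prs }
          Q₁ D₁ Q₁D₁≈ (e , 0<e , D₁e≢0) =
    let D′ , Q , QD′≋P , c , D₁≡ = gauss ps prs P Q₁ D₁ (λ i φ →
          trans (≈ₚ⇒≋ {p = Q₁ i *ₚ D₁} {scale (+ n) (P i)} (Q₁D₁≈ i) φ)
          (trans (⟦scale⟧ (+ n) (P i) φ) (cong (λ k → + k ℤ.* ⟦ P i ⟧ φ) n≡)))
    in D′ , Q , QD′≋P , e , 0<e , λ D′e≡0 → D₁e≢0
         (trans (coeff-⟦⟧ D₁ e) (trans (D₁≡ (δ e)) (trans
           (cong (c ℤ.*_) (trans (sym (coeff-⟦⟧ D′ e)) D′e≡0)) (ℤ.*-zeroʳ c))))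

-- Degrees and level sets

degreeOf : ∀ {r n} {p : Poly r} → Leading n p → ℕ
degreeOf l = Vec.sum (Leading.exponent l)

≉0⇒leading : ∀ {r} (p : Poly r) → ¬ p ≈ₚ 0ₚ → Leading 0ℤ p
≉0⇒leading p p≉0 with leading? 0ℤ p
... | inj₁ (_ , p≡0) = contradiction (λ e → trans (coeff-⟦⟧ p e) (p≡0 (δ e))) p≉0
... | inj₂ l         = l

coeff≢0⇒leading : ∀ {r} (p : Poly r) e → coeff p e ≢ 0ℤ → Leading 0ℤ p
coeff≢0⇒leading p e c≢0 = ≉0⇒leading p (λ p≈0 → c≢0 (p≈0 e))

-- A point mass above the leading exponent vanishes on the leading term and on everything below it,
-- so the coefficient there is 0. Below it the graded order compares the sums.
coeff≢0⇒sum≤ : ∀ {r} {p : Poly r} (l : Leading 0ℤ p) {e} → coeff p e ≢ 0ℤ →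
               Vec.sum e ℕ.≤ degreeOf l
coeff≢0⇒sum≤ {p = p} l {e} c≢0 with ≺-connex e (Leading.exponent l)
... | inj₁ e≺           = ≺⇒sum≤ e≺
... | inj₂ (inj₁ refl)  = ℕ.≤-refl
... | inj₂ (inj₂ ≺e)    = contradiction (trans (coeff-⟦⟧ p e) (ℤ.0∣⇒≡0
  (∣m-n∣n⇒∣m (leading-mod l (δ e) (λ d≺ → divides 0ℤ (δ-≢ (≺⇒≢ (<ₗ-trans d≺ ≺e)))))
    (ℤ.∣n⇒∣m*n (Leading.coefficient l) (divides 0ℤ (δ-≢ (≺⇒≢ ≺e))))))) c≢0

-- Since ℤ has no zero divisors, leading terms multiply without cancellation, and `d ⊕ e` really
-- occurs in `P`.
degree-of-factor : ∀ {r} {p q P : Poly r} (lp : Leading 0ℤ p) (lq : Leading 0ℤ q) →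
                   p *ₚ q ≋ P → degreeOf lq ℕ.≤ deg P
degree-of-factor {P = P} lp lq pq≋P = begin
  degreeOf lq                    ≤⟨ ℕ.m≤n+m _ (degreeOf lp) ⟩
  degreeOf lp ℕ.+ degreeOf lq    ≡⟨ sum-⊕ d e ⟨
  Vec.sum (d ⊕ e)                ≤⟨ coeff≉0⇒sum≤deg P (λ c≡0 → leading-product euclid-0 lp lq
    (divides 0ℤ (trans (pq≋P (δ (d ⊕ e))) (trans (sym (coeff-⟦⟧ P (d ⊕ e))) c≡0)))) ⟩
  deg P                          ∎
  where
  open ℕ.≤-Reasoning
  d = Leading.exponent lp
  e = Leading.exponent lq

-- The list `p` may contain cancelling terms of high degree, which would spoil the termwise bound in
-- `schwartz-zippel`. The leading term together with its tail is an equal polynomial free of them,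
-- as `multiple` enters with factor 0.
count-zeros : ∀ {r} {p : Poly r} (l : Leading 0ℤ p) → ∀ {S} → Unique S →
  count (vanishes? p) (power S r) ℕ.* length S ℕ.≤ degreeOf l ℕ.* length (power S r)
count-zeros {r} {p} l {S} uniq = ℕ.≤-trans
  (ℕ.*-monoˡ-≤ (length S) (count-mono (vanishes? p) (vanishes? p′)
    (All.universal (λ x px≡0 → trans (sym (eval-cong {p = p} {p′} p≋p′ x)) px≡0) (power S r))))
  (schwartz-zippel p′ (degreeOf l)
    record { exponent = exponent ; coefficient = coefficient ; multiple = [] ; tail = tail
           ; decomposition = λ φ → sym (ℤ.+-identityˡ _)
           ; tail≺ = tail≺ ; indivisible = indivisible }
    (ℕ.≤-refl ∷ All.map ≺⇒sum≤ tail≺) uniq)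
  where
  open Leading l
  p′ : Poly r
  p′ = (coefficient , exponent) ∷ tail
  p≋p′ : p ≋ p′
  p≋p′ φ = trans (decomposition φ) (ℤ.+-identityˡ _)

level? : ∀ {r} (p : Poly r) c → Decidable (λ x → eval p x ≡ c)
level? p c x = eval p x ℤ.≟ c

monomial-0 : ∀ {r} (x : Vec ℤ r) → monomial x (Vec.replicate r 0) ≡ 1ℤ
monomial-0 []       = refl
monomial-0 (x ∷ xs) = trans (ℤ.*-identityˡ _) (monomial-0 xs)

sum-replicate-0 : ∀ r → Vec.sum (Vec.replicate r 0) ≡ 0
sum-replicate-0 zero    = refl
sum-replicate-0 (suc r) = sum-replicate-0 r

-- Subtracting `c` alters only the constant coefficient. The coefficient at `e` survives, so p - c
-- is nonzero for every `c`; this is where positive degree is essential.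
count-level : ∀ {r} {p : Poly r} (l : Leading 0ℤ p) {e} → 0 ℕ.< Vec.sum e → coeff p e ≢ 0ℤ →
  ∀ c {S} → Unique S →
  count (level? p c) (power S r) ℕ.* length S ℕ.≤ degreeOf l ℕ.* length (power S r)
count-level {r} {p} l {e} 0<e pe≢0 c {S} uniq = begin
  count (level? p c) (power S r) ℕ.* length S
    ≤⟨ ℕ.*-monoˡ-≤ (length S) (count-mono (level? p c) (vanishes? p-c)
         (All.universal shift (power S r))) ⟩
  count (vanishes? p-c) (power S r) ℕ.* length S
    ≤⟨ count-zeros l′ uniq ⟩
  degreeOf l′ ℕ.* length (power S r)
    ≤⟨ ℕ.*-monoˡ-≤ (length (power S r)) degree≤ ⟩
  degreeOf l ℕ.* length (power S r) ∎
  where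
  open ℕ.≤-Reasoning
  0⃗ = Vec.replicate r 0
  p-c : Poly r
  p-c = (ℤ.- c , 0⃗) ∷ p

  shift : ∀ x → eval p x ≡ c → eval p-c x ≡ 0ℤ
  shift x px≡c = trans (cong₂ (λ m v → (ℤ.- c) ℤ.* m ℤ.+ v) (monomial-0 x) px≡c)
    (trans (cong (ℤ._+ c) (ℤ.*-identityʳ (ℤ.- c))) (ℤ.+-inverseˡ c))

  same-coeff : ∀ {d} → 0 ℕ.< Vec.sum d → coeff p-c d ≡ coeff p d
  same-coeff {d} 0<d = trans (coeff-⟦⟧ p-c d) (trans
    (cong (λ m → (ℤ.- c) ℤ.* m ℤ.+ ⟦ p ⟧ (δ d)) (δ-≢ {d = 0⃗} {d} (λ { refl →
      ℕ.<⇒≢ 0<d (sym (sum-replicate-0 r)) })))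
    (trans (cong (ℤ._+ ⟦ p ⟧ (δ d)) (ℤ.*-zeroʳ (ℤ.- c)))
      (trans (ℤ.+-identityˡ _) (sym (coeff-⟦⟧ p d)))))

  l′ : Leading 0ℤ p-c
  l′ = coeff≢0⇒leading p-c e (λ c≡0 → pe≢0 (trans (sym (same-coeff 0<e)) c≡0))

  degree≤ : degreeOf l′ ℕ.≤ degreeOf l
  degree≤ with degreeOf l′ ℕ.≟ 0
  ... | yes ≡0 = ℕ.≤-trans (ℕ.≤-reflexive ≡0) ℕ.z≤n
  -- The leading exponent of p - c now has positive sum, so its coefficient is shared with `p`.
  ... | no  ≢0 = coeff≢0⇒sum≤ l (λ p≡0 → leading-coeff l′
    (divides 0ℤ (trans (same-coeff (ℕ.n≢0⇒n>0 ≢0)) p≡0)))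

-- Covering by level sets

Unique-⊆⇒length≤ : ∀ {a} {A : Set a} {xs ys : List A} → Unique xs → xs ⊆ ys →
                   length xs ℕ.≤ length ys
Unique-⊆⇒length≤ {xs = []}     []            sub = ℕ.z≤n
Unique-⊆⇒length≤ {xs = x ∷ xs} (x∉xs ∷ uniq) sub
  with as , bs , refl ← ∈-∃++ (sub (here refl)) = begin
  suc (length xs)           ≤⟨ ℕ.s≤s (Unique-⊆⇒length≤ uniq sub′) ⟩
  suc (length (as ++ bs))   ≡⟨ List.length-++-sucʳ as x bs ⟨
  length (as ++ x ∷ bs)     ∎
  where
  open ℕ.≤-Reasoning
  sub′ : xs ⊆ as ++ bs
  sub′ y∈xs with ∈-++⁻ as (sub (there y∈xs))
  ... | inj₁ y∈as         = ∈-++⁺ˡ y∈as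
  ... | inj₂ (here refl)  = contradiction refl (All.lookup x∉xs y∈xs)
  ... | inj₂ (there y∈bs) = ∈-++⁺ʳ as y∈bs

nonzeroUpTo : ℕ → List ℤ
nonzeroUpTo K = map (λ i → + suc i) (upTo K) ++ map -[1+_] (upTo K)

length-nonzeroUpTo : ∀ K → length (nonzeroUpTo K) ≡ K ℕ.+ K
length-nonzeroUpTo K = trans (List.length-++ (map (λ i → + suc i) (upTo K)))
  (cong₂ ℕ._+_ (trans (List.length-map _ (upTo K)) (List.length-upTo K))
               (trans (List.length-map _ (upTo K)) (List.length-upTo K)))

∈-nonzeroUpTo : ∀ {K c} → c ≢ 0ℤ → ℤ.∣ c ∣ ℕ.≤ K → c ∈ nonzeroUpTo K
∈-nonzeroUpTo {c = + zero}   c≢0 _   = contradiction refl c≢0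
∈-nonzeroUpTo {c = + suc i}  _   i<K = ∈-++⁺ˡ (∈-map⁺ _ (∈-upTo⁺ i<K))
∈-nonzeroUpTo {K} {c = -[1+ i ]} _ i<K =
  ∈-++⁺ʳ (map (λ i → + suc i) (upTo K)) (∈-map⁺ _ (∈-upTo⁺ i<K))

-- Values of the gcd and the covering count

gcdOf : ∀ {s} → (Fin s → ℤ) → ℤ
gcdOf = Vector.foldr ℤ.gcd 0ℤ

gcdOf≡0⇒head≡0 : ∀ {s} (f : Fin (suc s) → ℤ) → gcdOf f ≡ 0ℤ → f zero ≡ 0ℤ
gcdOf≡0⇒head≡0 f = ℤ.gcd[i,j]≡0⇒i≡0 (f zero) (gcdOf (f ∘ suc))

gcdOf-nonNeg : ∀ {s} (f : Fin s → ℤ) → gcdOf f ≡ + ℤ.∣ gcdOf f ∣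
gcdOf-nonNeg {zero}  f = refl
gcdOf-nonNeg {suc s} f = refl

∣-gcdOf : ∀ {s d} (f : Fin s → ℤ) → (∀ i → d ℤᵤ.∣ f i) → d ℤᵤ.∣ gcdOf f
∣-gcdOf {zero}  {d} f d∣f = ℕ._∣0 ℤ.∣ d ∣
∣-gcdOf {suc s} {d} f d∣f = ℤ.gcd-greatest {f zero} {gcdOf (f ∘ suc)} {d} (d∣f zero)
  (∣-gcdOf {d = d} (f ∘ suc) (d∣f ∘ suc))

deg≤maxDeg : ∀ {r s} (P : Fin s → Poly r) i → deg (P i) ℕ.≤ maxDeg P
deg≤maxDeg P zero    = ℕ.m≤m⊔n _ _
deg≤maxDeg P (suc i) = ℕ.≤-trans (deg≤maxDeg (P ∘ suc) i) (ℕ.m≤n⊔m (deg (P zero)) _)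

length-concatMap-filter : ∀ {a p} {A : Set a} {P : ℤ → A → Set p}
  (P? : ∀ c → Decidable (P c)) T n b →
  (∀ c → count (P? c) T ℕ.* n ℕ.≤ b) → ∀ cs →
  length (concatMap (λ c → filter (P? c) T) cs) ℕ.* n ℕ.≤ length cs ℕ.* b
length-concatMap-filter P? T n b bound []       = ℕ.z≤n
length-concatMap-filter P? T n b bound (c ∷ cs) = begin
  length (filter (P? c) T ++ rest) ℕ.* n
    ≡⟨ cong (ℕ._* n) (List.length-++ (filter (P? c) T)) ⟩
  (count (P? c) T ℕ.+ length rest) ℕ.* n
    ≡⟨ ℕ.*-distribʳ-+ n (count (P? c) T) (length rest) ⟩
  count (P? c) T ℕ.* n ℕ.+ length rest ℕ.* n
    ≤⟨ ℕ.+-mono-≤ (bound c) (length-concatMap-filter P? T n b bound cs) ⟩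
  b ℕ.+ length cs ℕ.* b
    ∎
  where
  open ℕ.≤-Reasoning
  rest = concatMap (λ c → filter (P? c) T) cs

count-small-gcd : ∀ {r s} (P : Fin (suc s) → Poly r) (D′ : Poly r) (Q : Fin (suc s) → Poly r) →
  (∀ i → Q i *ₚ D′ ≋ P i) → ∀ {e} → 0 ℕ.< Vec.sum e → coeff D′ e ≢ 0ℤ → ¬ P zero ≈ₚ 0ₚ →
  ∀ {S} → Unique S → ∀ K {xs} → Unique xs →
  (∀ {x} → x ∈ xs → x ∈ power S r × ∃[ g ] gcdAt P x ≡ + g × g ℕ.≤ K) →
  length xs ℕ.* length S ℕ.≤ (1 ℕ.+ (K ℕ.+ K)) ℕ.* (maxDeg P ℕ.* length (power S r))
count-small-gcd {r} P D′ Q QD′≋P {e} 0<e D′e≢0 P₀≢0 {S} uniq K {xs} uniq-xs small = begin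
  length xs ℕ.* n
    ≤⟨ ℕ.*-monoˡ-≤ n (Unique-⊆⇒length≤ uniq-xs cover) ⟩
  length (filter (vanishes? (P zero)) T ++ concatMap levelSet (nonzeroUpTo K)) ℕ.* n
    ≡⟨ cong (ℕ._* n) (List.length-++ (filter (vanishes? (P zero)) T)) ⟩
  (count (vanishes? (P zero)) T ℕ.+ length (concatMap levelSet (nonzeroUpTo K))) ℕ.* n
    ≡⟨ ℕ.*-distribʳ-+ n (count (vanishes? (P zero)) T) _ ⟩
  count (vanishes? (P zero)) T ℕ.* n ℕ.+ length (concatMap levelSet (nonzeroUpTo K)) ℕ.* n
    ≤⟨ ℕ.+-mono-≤
         (ℕ.≤-trans (count-zeros lP uniq) (ℕ.*-monoˡ-≤ N degP))
         (length-concatMap-filter (level? D′) T n (maxDeg P ℕ.* N)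
           (λ c → ℕ.≤-trans (count-level lD 0<e D′e≢0 c uniq) (ℕ.*-monoˡ-≤ N degD))
           (nonzeroUpTo K)) ⟩
  maxDeg P ℕ.* N ℕ.+ length (nonzeroUpTo K) ℕ.* (maxDeg P ℕ.* N)
    ≡⟨ cong (λ m → maxDeg P ℕ.* N ℕ.+ m ℕ.* (maxDeg P ℕ.* N)) (length-nonzeroUpTo K) ⟩
  (1 ℕ.+ (K ℕ.+ K)) ℕ.* (maxDeg P ℕ.* N)
    ∎
  where
  open ℕ.≤-Reasoning
  T = power S r
  n = length S
  N = length T

  levelSet : ℤ → List (Vec ℤ r)
  levelSet c = filter (level? D′ c) T

  lD : Leading 0ℤ D′
  lD = coeff≢0⇒leading D′ e D′e≢0

  lP : Leading 0ℤ (P zero)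
  lP = ≉0⇒leading (P zero) P₀≢0

  lQ : Leading 0ℤ (Q zero)
  lQ = ≉0⇒leading (Q zero) (λ Q₀≈0 → P₀≢0 (λ e → trans (coeff-⟦⟧ (P zero) e)
    (trans (sym (QD′≋P zero (δ e))) (trans (⟦*ₚ⟧ (Q zero) D′ (δ e))
      (≈ₚ⇒≋ {p = Q zero} {0ₚ} Q₀≈0 _)))))

  degP : degreeOf lP ℕ.≤ maxDeg P
  degP = ℕ.≤-trans (coeff≉0⇒sum≤deg (P zero) (λ c≡0 → leading-coeff lP (divides 0ℤ c≡0)))
                   (deg≤maxDeg P zero)

  degD : degreeOf lD ℕ.≤ maxDeg P
  degD = ℕ.≤-trans (degree-of-factor {P = P zero} lQ lD (QD′≋P zero)) (deg≤maxDeg P zero)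

  D′∣P : ∀ x i → eval D′ x ℤᵤ.∣ eval (P i) x
  D′∣P x i = ℤ.∣⇒∣ᵤ (divides (eval (Q i) x)
    (trans (sym (eval-cong {p = Q i *ₚ D′} {P i} (QD′≋P i) x)) (eval-*ₚ (Q i) D′ x)))

  -- The exceptional set is the zero set of `P zero`, not of `D′`: where the gcd is 0 the value of
  -- `D′` may be nonzero and large, but `P zero` vanishes. Off this set the gcd is positive, so its
  -- divisor `D′` has a nonzero value of size at most `K`.
  cover : xs ⊆ filter (vanishes? (P zero)) T ++ concatMap levelSet (nonzeroUpTo K)
  cover {x} x∈xs with x∈T , g , gcd≡ , g≤K ← small x∈xs with eval (P zero) x ℤ.≟ 0ℤ
  ... | yes Px≡0 = ∈-++⁺ˡ (∈-filter⁺ (vanishes? (P zero)) x∈T Px≡0)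
  ... | no  Px≢0 = ∈-++⁺ʳ (filter (vanishes? (P zero)) T)
    (∈-concatMap⁺ levelSet (Any.map (λ { refl → ∈-filter⁺ (level? D′ _) x∈T refl })
      (∈-nonzeroUpTo D′x≢0 (ℕ.≤-trans (ℕ.∣⇒≤ {{ℕ.≢-nonZero g≢0}} D′x∣g) g≤K))))
    where
    D′x∣g : ℤ.∣ eval D′ x ∣ ℕ.∣ g
    D′x∣g = subst (λ z → ℤ.∣ eval D′ x ∣ ℕ.∣ ℤ.∣ z ∣) gcd≡
      (∣-gcdOf {d = eval D′ x} (λ i → eval (P i) x) (D′∣P x))
    D′x≢0 : eval D′ x ≢ 0ℤ
    D′x≢0 D′x≡0 = Px≢0 (ℤ.0∣⇒≡0 (subst (ℤ._∣ eval (P zero) x) D′x≡0 (ℤ.∣ᵤ⇒∣ (D′∣P x zero))))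
    g≢0 : g ≢ 0
    g≢0 refl = Px≢0 (gcdOf≡0⇒head≡0 (λ i → eval (P i) x) gcd≡)

-- Real numbers

fromℚᵘ-mono-≤ : ∀ {p q} → p ℚᵘ.≤ q → ℚ.fromℚᵘ p ℚ.≤ ℚ.fromℚᵘ q
fromℚᵘ-mono-≤ {p} {q} p≤q = ℚ.toℚᵘ-cancel-≤
  (ℚᵘ.≤-respˡ-≃ (ℚᵘ.≃-sym (ℚ.toℚᵘ-fromℚᵘ p))
    (ℚᵘ.≤-respʳ-≃ (ℚᵘ.≃-sym (ℚ.toℚᵘ-fromℚᵘ q)) p≤q))

fromℚᵘ-mono-< : ∀ {p q} → p ℚᵘ.< q → ℚ.fromℚᵘ p ℚ.< ℚ.fromℚᵘ q
fromℚᵘ-mono-< {p} {q} p<q = ℚ.toℚᵘ-cancel-<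
  (ℚᵘ.<-respˡ-≃ (ℚᵘ.≃-sym (ℚ.toℚᵘ-fromℚᵘ p))
    (ℚᵘ.<-respʳ-≃ (ℚᵘ.≃-sym (ℚ.toℚᵘ-fromℚᵘ q)) p<q))

ι-mono-≤ : ∀ {m n} → m ℕ.≤ n → ι (+ m) ℚ.≤ ι (+ n)
ι-mono-≤ {m} {n} m≤n = fromℚᵘ-mono-≤ {mkℚᵘ (+ m) 0} {mkℚᵘ (+ n) 0}
  (*≤* (ℤ.*-monoʳ-≤-nonNeg (+ 1) (ℤ.+≤+ m≤n)))

0≤/ : ∀ m n .{{_ : ℕ.NonZero n}} → 0ℚ ℚ.≤ + m ℚ./ n
0≤/ m n@(suc _) = fromℚᵘ-mono-≤ {mkℚᵘ 0ℤ 0} {mkℚᵘ (+ m) _}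
  (*≤* (subst₂ ℤ._≤_ (sym (ℤ.*-zeroˡ (+ n))) (sym (ℤ.*-identityʳ (+ m))) (ℤ.+≤+ ℕ.z≤n)))

/≤*/ : ∀ a b l n t .{{_ : ℕ.NonZero n}} .{{t≢0 : ℕ.NonZero t}} →
       a ℕ.* n ℕ.≤ b ℕ.* (l ℕ.* t) → + a ℚ./ t ℚ.≤ ι (+ b) ℚ.* (+ l ℚ./ n)
/≤*/ a b l n@(suc n-1) t@(suc t-1) an≤blt =
  subst (+ a ℚ./ t ℚ.≤_) (fromℚᵘ-homo-* (mkℚᵘ (+ b) 0) (mkℚᵘ (+ l) n-1))
    (fromℚᵘ-mono-≤ {mkℚᵘ (+ a) t-1} {mkℚᵘ (+ b) 0 ℚᵘ.* mkℚᵘ (+ l) n-1}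
      (*≤* (subst₂ ℤ._≤_ left right (ℤ.+≤+ an≤blt))))
  where
  left : + (a ℕ.* n) ≡ + a ℤ.* + (1 ℕ.* n)
  left = trans (ℤ.pos-* a n) (cong (λ m → + a ℤ.* + m) (sym (ℕ.*-identityˡ n)))
  right : + (b ℕ.* (l ℕ.* t)) ≡ + b ℤ.* + l ℤ.* + t
  right = trans (ℤ.pos-* b (l ℕ.* t)) (trans (cong (+ b ℤ.*_) (ℤ.pos-* l t))
    (sym (ℤ.*-assoc (+ b) (+ l) (+ t))))

floor : ∀ p → 0ℚ ℚ.≤ p → ∃[ K ] ι (+ K) ℚ.≤ p × p ℚ.< ι (+ suc K)
floor p@(mkℚ -[1+ _ ] _ _) (ℚ.*≤* ())
floor p@(mkℚ (+ n) d-1 _)  _ =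
  K , subst (ι (+ K) ℚ.≤_) (ℚ.fromℚᵘ-toℚᵘ p)
        (fromℚᵘ-mono-≤ {mkℚᵘ (+ K) 0} {ℚ.toℚᵘ p} (*≤* lower))
    , subst (ℚ._< ι (+ suc K)) (ℚ.fromℚᵘ-toℚᵘ p)
        (fromℚᵘ-mono-< {ℚ.toℚᵘ p} {mkℚᵘ (+ suc K) 0} (*<* upper))
  where
  d = suc d-1
  K = n ℕ./ d
  lower : + K ℤ.* + d ℤ.≤ + n ℤ.* + 1
  lower = subst₂ ℤ._≤_ (ℤ.pos-* K d) (sym (ℤ.*-identityʳ (+ n))) (ℤ.+≤+ (ℕ.m/n*n≤m n d))
  upper : + n ℤ.* + 1 ℤ.< + suc K ℤ.* + d
  upper = subst₂ ℤ._<_ (sym (ℤ.*-identityʳ (+ n))) (ℤ.pos-* (suc K) d)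
    (ℤ.+<+ (subst (ℕ._< suc K ℕ.* d) (sym (ℕ.m≡m%n+[m/n]*n n d))
      (ℕ.+-monoˡ-< (K ℕ.* d) (ℕ.m%n<n n d))))

-- Choice of the integer threshold

p≤∣p∣ : ∀ p → p ℚ.≤ ℚ.∣ p ∣
p≤∣p∣ p with ℚ.≤-total 0ℚ p
... | inj₁ 0≤p = ℚ.≤-reflexive (sym (ℚ.0≤p⇒∣p∣≡p 0≤p))
... | inj₂ p≤0 = ℚ.≤-trans p≤0 (ℚ.0≤∣p∣ p)

∣-∣<⇒≤+ : ∀ {p q ε} → ℚ.∣ p ℚ.- q ∣ ℚ.< ε → p ℚ.≤ q ℚ.+ ε
∣-∣<⇒≤+ {p} {q} {ε} ∣p-q∣<ε = subst (ℚ._≤ q ℚ.+ ε) (cancel p q)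
  (ℚ.+-monoʳ-≤ q (ℚ.≤-trans (p≤∣p∣ (p ℚ.- q)) (ℚ.<⇒≤ ∣p-q∣<ε)))
  where
  cancel : ∀ p q → q ℚ.+ (p ℚ.- q) ≡ p
  cancel = solve 2 (λ p q → q :+ (p :- q) := p) refl
    where open ℚ.+-*-Solver

0<q-p : ∀ {p q} → p ℚ.< q → 0ℚ ℚ.< q ℚ.- p
0<q-p {p} {q} p<q = subst (ℚ._< q ℚ.- p) (ℚ.+-inverseʳ p) (ℚ.+-monoˡ-< (ℚ.- p) p<q)

choose-ε : ∀ L δ → 0ℚ ℚ.≤ L → 0ℚ ℚ.< δ → Σ[ ε ∈ ℚ ] 0ℚ ℚ.< ε × ι (+ 2) ℚ.* (ε ℚ.* L) ℚ.< δ
choose-ε L δ 0≤L 0<δ = ε , 0<ε , subst₂ ℚ._<_ (ℚ.+-identityʳ _) 2εL+ε≡δ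
  (ℚ.+-monoʳ-< (ι (+ 2) ℚ.* (ε ℚ.* L)) 0<ε)
  where
  -- Taking ε = δ / (2L + 1), the summand 1 keeps the denominator positive when L = 0 and leaves a
  -- spare ε that makes the inequality strict.
  A : ℚ
  A = ι (+ 2) ℚ.* L ℚ.+ 1ℚ

  0<A : 0ℚ ℚ.< A
  0<A = ℚ.+-mono-≤-< {0ℚ} {ι (+ 2) ℚ.* L} {0ℚ} {1ℚ}
    (subst (ℚ._≤ ι (+ 2) ℚ.* L) (ℚ.*-zeroʳ (ι (+ 2))) (ℚ.*-monoˡ-≤-nonNeg (ι (+ 2)) 0≤L))
    (ℚ.positive⁻¹ 1ℚ)

  instance
    A-positive : ℚ.Positive A
    A-positive = ℚ.positive 0<A
    A-nonZero : ℚ.NonZero A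
    A-nonZero = ℚ.pos⇒nonZero A

  ε : ℚ
  ε = δ ℚ.* ℚ.1/ A

  0<ε : 0ℚ ℚ.< ε
  0<ε = ℚ.positive⁻¹ ε {{ℚ.pos*pos⇒pos δ {{ℚ.positive 0<δ}} (ℚ.1/ A) {{ℚ.1/pos⇒pos A}}}}

  factor : ∀ ε L → ι (+ 2) ℚ.* (ε ℚ.* L) ℚ.+ ε ≡ ε ℚ.* (ι (+ 2) ℚ.* L ℚ.+ 1ℚ)
  factor ε L = trans
    (cong₂ ℚ._+_ (p*qr≡q*pr (ι (+ 2)) ε L) (sym (ℚ.*-identityʳ ε)))
    (sym (ℚ.*-distribˡ-+ ε (ι (+ 2) ℚ.* L) 1ℚ))

  2εL+ε≡δ : ι (+ 2) ℚ.* (ε ℚ.* L) ℚ.+ ε ≡ δ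
  2εL+ε≡δ = trans (factor ε L) (trans (ℚ.*-assoc δ (ℚ.1/ A) A)
    (trans (cong (δ ℚ.*_) (ℚ.*-inverseˡ A)) (ℚ.*-identityʳ δ)))

double : ∀ p → ι (+ 2) ℚ.* p ≡ p ℚ.+ p
double p = trans (ℚ.*-distribʳ-+ p 1ℚ 1ℚ) (cong₂ ℚ._+_ (ℚ.*-identityˡ p) (ℚ.*-identityˡ p))

-- Replacing `K` by its bound κ + ε costs at most 2εL, which is less than the gap δ.
2K+1-estimate : ∀ K κ {ε L δ R} → 0ℚ ℚ.≤ L → ι (+ K) ℚ.≤ κ ℚ.+ ε →
  ι (+ 2) ℚ.* (ε ℚ.* L) ℚ.< δ → (ι (+ 2) ℚ.* κ ℚ.+ ι (+ 1)) ℚ.* L ℚ.+ δ ℚ.≤ R →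
  ι (+ (1 ℕ.+ (K ℕ.+ K))) ℚ.* L ℚ.< R
2K+1-estimate K κ {ε} {L} {δ} {R} 0≤L K≤κ+ε 2εL<δ gap = begin-strict
  ι (+ (1 ℕ.+ (K ℕ.+ K))) ℚ.* L
    ≡⟨ cong (ℚ._* L) (trans (ι-homo-+ (+ 1) (+ (K ℕ.+ K)))
         (cong (ι (+ 1) ℚ.+_) (ι-homo-+ (+ K) (+ K)))) ⟩
  (ι (+ 1) ℚ.+ (ι (+ K) ℚ.+ ι (+ K))) ℚ.* L
    ≤⟨ ℚ.*-monoʳ-≤-nonNeg L {{ℚ.nonNegative 0≤L}}
         (ℚ.+-monoʳ-≤ (ι (+ 1)) (ℚ.+-mono-≤ K≤κ+ε K≤κ+ε)) ⟩
  (ι (+ 1) ℚ.+ ((κ ℚ.+ ε) ℚ.+ (κ ℚ.+ ε))) ℚ.* L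
    ≡⟨ expand (ι (+ 1)) κ ε L ⟩
  ((κ ℚ.+ κ) ℚ.+ ι (+ 1)) ℚ.* L ℚ.+ (ε ℚ.* L ℚ.+ ε ℚ.* L)
    ≡⟨ cong₂ (λ x y → (x ℚ.+ ι (+ 1)) ℚ.* L ℚ.+ y) (double κ) (double (ε ℚ.* L)) ⟨
  (ι (+ 2) ℚ.* κ ℚ.+ ι (+ 1)) ℚ.* L ℚ.+ ι (+ 2) ℚ.* (ε ℚ.* L)
    <⟨ ℚ.+-monoʳ-< ((ι (+ 2) ℚ.* κ ℚ.+ ι (+ 1)) ℚ.* L) 2εL<δ ⟩
  (ι (+ 2) ℚ.* κ ℚ.+ ι (+ 1)) ℚ.* L ℚ.+ δ
    ≤⟨ gap ⟩
  R ∎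
  where
  open ℚ.≤-Reasoning
  expand : ∀ o κ ε L → (o ℚ.+ ((κ ℚ.+ ε) ℚ.+ (κ ℚ.+ ε))) ℚ.* L ≡
                       ((κ ℚ.+ κ) ℚ.+ o) ℚ.* L ℚ.+ (ε ℚ.* L ℚ.+ ε ℚ.* L)
  expand = solve 4 (λ o κ ε L →
    (o :+ ((κ :+ ε) :+ (κ :+ ε))) :* L :=
    ((κ :+ κ) :+ o) :* L :+ (ε :* L :+ ε :* L)) refl
    where open ℚ.+-*-Solver

-- The order `_≤ℝ_` is a negation, so the decidable g ≤ K is tested instead. An integer g > K is at
-- least K + 1 > q, and g - q would be a gap witnessing `k <ℝ fromℤ (+ g)`.
≤ℝ⇒≤ : ∀ k {q} M g K → (∀ m → M ℕ.≤ m → seq k m ℚ.≤ q) → q ℚ.< ι (+ suc K) →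
       fromℤ (+ g) ≤ℝ k → g ℕ.≤ K
≤ℝ⇒≤ k {q} M g K k≤q q<1+K g≤k with g ℕ.≤? K
... | yes g≤K = g≤K
... | no  g≰K = contradiction (ι (+ g) ℚ.- q , 0<q-p q<g , M , below) g≤k
  where
  q<g : q ℚ.< ι (+ g)
  q<g = ℚ.<-≤-trans q<1+K (ι-mono-≤ (ℕ.≰⇒> g≰K))
  cancel : ∀ p q → p ℚ.+ (q ℚ.- p) ≡ q
  cancel = solve 2 (λ p q → p :+ (q :- p) := q) refl
    where open ℚ.+-*-Solver
  below : ∀ m → M ℕ.≤ m → seq k m ℚ.+ (ι (+ g) ℚ.- q) ℚ.≤ ι (+ g)
  below m M≤m = subst (seq k m ℚ.+ (ι (+ g) ℚ.- q) ℚ.≤_) (cancel q (ι (+ g)))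
    (ℚ.+-monoˡ-≤ (ι (+ g) ℚ.- q) (k≤q m M≤m))

-- Here `K` is the floor of the rational κ + ε, where κ is a late term of `seq k`. Adding ε puts all
-- late terms of the sequence at or below it, so no natural number up to `k` is lost; the resulting
-- excess over ⌊k⌋ is absorbed by δ. Positivity of `k` makes this floor a natural number.
threshold : ∀ (k : ℝ) → fromℤ (+ 0) <ℝ k → ∀ L R → 0ℚ ℚ.≤ L →
  (fromℤ (+ 2) *ℝ k +ℝ fromℤ (+ 1)) *ℝ fromℚ L <ℝ fromℚ R →
  ∃[ K ] (∀ g → fromℤ (+ g) ≤ℝ k → g ℕ.≤ K) × ι (+ (1 ℕ.+ (K ℕ.+ K))) ℚ.* L ℚ.< R
threshold k (γ , 0<γ , M₁ , k>γ) L R 0≤L (δ , 0<δ , M₂ , gap) =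
  let ε , 0<ε , 2εL<δ = choose-ε L δ 0≤L 0<δ
      M₃ , close = cauchy k ε 0<ε
  in choose-K ε 0<ε 2εL<δ M₃ close
  where
  module _ (ε : ℚ) (0<ε : 0ℚ ℚ.< ε) (2εL<δ : ι (+ 2) ℚ.* (ε ℚ.* L) ℚ.< δ) (M₃ : ℕ)
           (close : ∀ m n → M₃ ℕ.≤ m → M₃ ℕ.≤ n → ℚ.∣ seq k m ℚ.- seq k n ∣ ℚ.< ε) where
    M : ℕ
    M = M₁ ℕ.⊔ (M₂ ℕ.⊔ M₃)

    κ : ℚ
    κ = seq k M

    0≤κ+ε : 0ℚ ℚ.≤ κ ℚ.+ ε
    0≤κ+ε = ℚ.+-mono-≤ {0ℚ} {κ} {0ℚ} {ε}
      (ℚ.≤-trans (ℚ.<⇒≤ (subst (0ℚ ℚ.<_) (sym (ℚ.+-identityˡ γ)) 0<γ)) (k>γ M (ℕ.m≤m⊔n M₁ _)))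
      (ℚ.<⇒≤ 0<ε)

    gap-M : (ι (+ 2) ℚ.* κ ℚ.+ ι (+ 1)) ℚ.* L ℚ.+ δ ℚ.≤ R
    gap-M = gap M (ℕ.≤-trans (ℕ.m≤m⊔n M₂ M₃) (ℕ.m≤n⊔m M₁ _))

    conclude : ∃[ K ] ι (+ K) ℚ.≤ κ ℚ.+ ε × κ ℚ.+ ε ℚ.< ι (+ suc K) →
      ∃[ K ] (∀ g → fromℤ (+ g) ≤ℝ k → g ℕ.≤ K) × ι (+ (1 ℕ.+ (K ℕ.+ K))) ℚ.* L ℚ.< R
    conclude (K , K≤κ+ε , κ+ε<1+K) = K
      , (λ g → ≤ℝ⇒≤ k M₃ g K (λ m M₃≤m → ∣-∣<⇒≤+ {seq k m} {κ} {ε}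
          (close m M M₃≤m (ℕ.≤-trans (ℕ.m≤n⊔m M₂ M₃) (ℕ.m≤n⊔m M₁ _)))) κ+ε<1+K)
      , 2K+1-estimate K κ {ε} 0≤L K≤κ+ε 2εL<δ gap-M

    choose-K : ∃[ K ] (∀ g → fromℤ (+ g) ≤ℝ k → g ℕ.≤ K) × ι (+ (1 ℕ.+ (K ℕ.+ K))) ℚ.* L ℚ.< R
    choose-K = conclude (floor (κ ℚ.+ ε) 0≤κ+ε)

theorem1p9 : (r s : ℕ) → 1 ≤ r → 2 ≤ s →
    (P : Fin s → ℤ[X].Poly r) → (∀ i → ¬ (P i ℤ[X].≈ₚ ℤ[X].0ₚ)) →
    (S : List ℤ) → Unique S → .{{_ : NonZero (length S)}} →
    (k : ℝ) → fromℤ (+ 0) <ℝ k →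
    (N : ℕ) → HasCardinality (λ n → n ∈ power S r × fromℤ (gcdAt P n) ≤ℝ k) N →
    (fromℤ (+ 2) *ℝ k +ℝ fromℤ (+ 1)) *ℝ fromℚ (+ maxDeg P / length S) <ℝ
    fromℚ ((+ N / length (power S r)) {{power-nonZero S r}}) →
    Coprime P
theorem1p9 r (suc s) _ _ P P≢0 S uniq k 0<k N (xs , uniq-xs , xs⇔ , xs≡N) ratio (D , 0<deg , D∣P) =
  let D′ , Q , QD′≋P , e , 0<e , D′e≢0 = integral-divisor P D 0<deg D∣P
      K , ≤K , 2K+1< = threshold k 0<k (+ maxDeg P ℚ./ length S)
        ((+ N ℚ./ length (power S r)) {{power-nonZero S r}}) (0≤/ (maxDeg P) (length S)) ratio
  -- With the same `K`, `threshold` puts the density above (2K + 1) ℓ / #S, and the covering count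
  -- puts it at or below.
  in ℚ.<-irrefl refl (ℚ.<-≤-trans 2K+1<
       (/≤*/ N (1 ℕ.+ (K ℕ.+ K)) (maxDeg P) (length S) (length (power S r))
         {{t≢0 = power-nonZero S r}}
         (subst
           (λ m → m ℕ.* length S ℕ.≤ (1 ℕ.+ (K ℕ.+ K)) ℕ.* (maxDeg P ℕ.* length (power S r))) xs≡N
           (count-small-gcd P D′ Q QD′≋P 0<e D′e≢0 (P≢0 zero) uniq K uniq-xs (small K ≤K)))))
  where
  small : ∀ K → (∀ g → fromℤ (+ g) ≤ℝ k → g ℕ.≤ K) →
          ∀ {x} → x ∈ xs → x ∈ power S r × ∃[ g ] gcdAt P x ≡ + g × g ℕ.≤ K
  small K ≤K {x} x∈xs =
    proj₁ (Equivalence.to (xs⇔ x) x∈xs) , ℤ.∣ gcdAt P x ∣ , nonNeg ,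
    ≤K ℤ.∣ gcdAt P x ∣ (subst (λ d → fromℤ d ≤ℝ k) nonNeg (proj₂ (Equivalence.to (xs⇔ x) x∈xs)))
    where
    nonNeg : gcdAt P x ≡ + ℤ.∣ gcdAt P x ∣
    nonNeg = gcdOf-nonNeg (λ i → eval (P i) x)
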